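{- Let $S\subseteq\Sigma^*$ be a tight paddable set. Then, for each $A\subseteq\Sigma^*$, the following are equivalent: (1) $A\leq^p_T S$; (2) $A\leq^p_{li\text{ - }T}S$; (3) $A\leq^p_{ld\text{ - }T}S$; (4) $A\leq^p_{s\text{ - }li\text{ - }T}S$.
   Context: $\Sigma=\{0,1\}$; $|x|$ is the length of $x$. A set $S\subseteq\Sigma^*$ is tight paddable if there are a polynomial-time computable $\sigma:\Sigma^*\to\Sigma^*$ and $k\in\mathbb{N}$ such that for each $x\in\Sigma^*$: $\sigma(x)\in S$ if and only if $x\in S$, and $|x|<|\sigma(x)|\le|x|+k$. A DPTM is a deterministic oracle Turing machine $M$ for which there is one polynomial $p$ such that, for every oracle $X\subseteq\Sigma^*$ and input $x$, $M^X(x)$ halts within $p(|x|)$ steps; $L(M^X)$ is the set of inputs accepted with oracle $X$. $A\leq^p_T S$: there is a DPTM $M$ with $L(M^S)=A$. $A\leq^p_{li\text{ - }T}S$, $A\leq^p_{ld\text{ - }T}S$, $A\leq^p_{s\text{ - }li\text{ - }T}S$: there is a DPTM $M$ with $L(M^S)=A$ such that for every input $x$, either $M^S(x)$ makes no oracle queries, or the sequence $q_1,\dots,q_k$ ($k\ge1$), in order, of its queries satisfies, respectively, $|q_1|<\dots<|q_k|$; $|q_1|>\dots>|q_k|$; $|x|<|q_1|<\dots<|q_k|$. -}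

module Defs where

open import Level using (0ℓ)
open import Data.Bool.Base using (Bool; true)
open import Data.Fin.Base using (Fin)
open import Data.List.Base using (List; []; _∷_; map; length; foldr)
open import Data.List.Relation.Unary.Linked using (Linked)
open import Data.Nat.Base using (ℕ; suc; _+_; _*_; _≤_; _<_; _>_)
open import Data.Product.Base using (Σ-syntax; ∃-syntax; _×_; _,_)
open import Data.Sum.Base using (_⊎_)
open import Data.Vec.Base using (Vec; _∷_; head; tail; replicate; zipWith)
  renaming (map to mapᵛ)
open import Function.Bundles using (_⇔_; _↔_)
open import Relation.Binary.PropositionalEquality.Core using (_≡_; _≢_)
open import Relation.Unary using (Pred; _∈_; _∉_; ∅)

Word : Set
Word = List Bool

-- Arbitrary predicates: membership need not be decidable.
Language : Set₁
Language = Pred Word 0ℓ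

-- The coefficients, constant term first.
Polynomial : Set
Polynomial = List ℕ

eval : Polynomial → ℕ → ℕ
eval p n = foldr (λ a v → a + n * v) 0 p

IsFinite : Set → Set
IsFinite A = ∃[ n ] (A ↔ Fin n)

------------------------------------------------------------------------
-- Tapes

-- The tape alphabet consists of the blank, the two input letters and the
-- machine's own auxiliary symbols.
data Symbol (Aux : Set) : Set where
  blank : Symbol Aux
  bit   : Bool → Symbol Aux
  aux   : Aux → Symbol Aux

data Direction : Set where
  left stay right : Direction

-- A two-way infinite tape: the cells to the left of the head (nearest
-- first), the scanned cell and the cells to the right of the head (nearest
-- first).  All cells beyond the two lists are blank.
record Tape (Aux : Set) : Set where
  constructor tape
  field
    lefts   : List (Symbol Aux)
    scanned : Symbol Aux
    rights  : List (Symbol Aux)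

open Tape public

module _ {Aux : Set} where

  shift : Direction → Tape Aux → Tape Aux
  shift stay  t                   = t
  shift left  (tape []       a r) = tape [] blank (a ∷ r)
  shift left  (tape (b ∷ l)  a r) = tape l b (a ∷ r)
  shift right (tape l a [])       = tape (a ∷ l) blank []
  shift right (tape l a (b ∷ r))  = tape (a ∷ l) b r

  writeShift : Symbol Aux × Direction → Tape Aux → Tape Aux
  writeShift (a , d) t = shift d (record t { scanned = a })

  emptyTape : Tape Aux
  emptyTape = tape [] blank []

  -- The head scans the first letter of the word.
  wordTape : Word → Tape Aux
  wordTape []      = emptyTape
  wordTape (b ∷ w) = tape [] (bit b) (map bit w)

  leadingBits : List (Symbol Aux) → Word
  leadingBits (bit b ∷ s) = b ∷ leadingBits s
  leadingBits _           = []

  -- The word that starts at the scanned cell and extends to the right up to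
  -- the first cell that does not hold a letter.
  tapeWord : Tape Aux → Word
  tapeWord t = leadingBits (scanned t ∷ rights t)

------------------------------------------------------------------------
-- Deterministic oracle Turing machines

data Instruction (State Aux : Set) (tapes : ℕ) : Set where
  halt  : (accepting : Bool) → Instruction State Aux tapes
  query : (yes no : State) → Instruction State Aux tapes
  move  : (Vec (Symbol Aux) tapes →
           State × Vec (Symbol Aux × Direction) tapes) →
          Instruction State Aux tapes

-- There are 2 + work tapes.  The first one initially holds the input.  The
-- second one is the query tape of an oracle machine, and the output tape of
-- a machine that computes a function.
record Machine : Set₁ where
  field
    State       : Set
    finiteState : IsFinite State
    Aux         : Set
    finiteAux   : IsFinite Aux
    work        : ℕ
    start       : State
    instruction : State → Instruction State Aux (2 + work)

module _ (M : Machine) where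
  open Machine M

  record Configuration : Set where
    constructor config
    field
      state : State
      tapes : Vec (Tape Aux) (2 + work)

  open Configuration

  initial : Word → Configuration
  initial x = config start (wordTape x ∷ replicate (1 + work) emptyTape)

  secondTapeWord : Configuration → Word
  secondTapeWord c = tapeWord (head (tail (tapes c)))

  perform : State × Vec (Symbol Aux × Direction) (2 + work) →
            Configuration → Configuration
  perform (q , as) c = config q (zipWith writeShift as (tapes c))

  -- Computation X c n qs d: with oracle X, the machine gets from c to d in
  -- exactly n steps, and the queries it makes on the way are qs, in order.
  -- A query is one step and leaves the tapes unchanged.
  data Computation (X : Language) :
         Configuration → ℕ → List Word → Configuration → Set where
    done : ∀ {c} → Computation X c 0 [] c
    step : ∀ {c n qs d δ} →
           instruction (state c) ≡ move δ →
           Computation X (perform (δ (mapᵛ scanned (tapes c))) c) n qs d →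
           Computation X c (suc n) qs d
    yes  : ∀ {c n qs d q⁺ q⁻} →
           instruction (state c) ≡ query q⁺ q⁻ →
           secondTapeWord c ∈ X →
           Computation X (config q⁺ (tapes c)) n qs d →
           Computation X c (suc n) (secondTapeWord c ∷ qs) d
    no   : ∀ {c n qs d q⁺ q⁻} →
           instruction (state c) ≡ query q⁺ q⁻ →
           secondTapeWord c ∉ X →
           Computation X (config q⁻ (tapes c)) n qs d →
           Computation X c (suc n) (secondTapeWord c ∷ qs) d

  HaltsWith : Configuration → Bool → Set
  HaltsWith c b = instruction (state c) ≡ halt b

  Halted : Configuration → Set
  Halted c = ∃[ b ] HaltsWith c b

  -- Classically every non-halting configuration has a successor, so halting
  -- within t steps means that no computation is longer than t.  Asking
  -- instead for a halting computation would, constructively, demand a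
  -- decision of every queried word even for undecidable X.
  HaltsWithin : Language → Word → ℕ → Set
  HaltsWithin X x t =
    ∀ {n qs c} → Computation X (initial x) n qs c → n ≤ t

  L : Language → Language
  L X x = ∃[ n ] ∃[ qs ] ∃[ c ]
    (Computation X (initial x) n qs c × HaltsWith c true)

  -- qs is the sequence of all queries made on input x.
  Queries : Language → Word → List Word → Set
  Queries X x qs = ∃[ n ] ∃[ c ]
    (Computation X (initial x) n qs c × Halted c)

  QueryFree : Set
  QueryFree = ∀ q {q⁺ q⁻} → instruction q ≢ query q⁺ q⁻

  -- The oracle ∅ plays no role for a query-free machine.
  ComputesWithin : Word → Word → ℕ → Set
  ComputesWithin x y t = ∃[ n ] ∃[ c ]
    (n ≤ t × Computation ∅ (initial x) n [] c × Halted c ×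
     secondTapeWord c ≡ y)

IsDPTM : Machine → Set₁
IsDPTM M = ∃[ p ] (∀ (X : Language) x → HaltsWithin M X x (eval p (length x)))

PolyTimeComputable : (Word → Word) → Set₁
PolyTimeComputable f = Σ[ M ∈ Machine ] (QueryFree M ×
  ∃[ p ] (∀ x → ComputesWithin M x (f x) (eval p (length x))))

TightPaddable : Language → Set₁
TightPaddable S = Σ[ σ ∈ (Word → Word) ] Σ[ k ∈ ℕ ] (PolyTimeComputable σ ×
  (∀ x → (σ x ∈ S ⇔ x ∈ S) ×
         length x < length (σ x) × length (σ x) ≤ length x + k))

------------------------------------------------------------------------
-- Polynomial-time Turing reducibilities

Decides : Machine → Language → Language → Set
Decides M S A = ∀ x → (x ∈ L M S ⇔ x ∈ A)

infix 4 _≤ᵖT_ _≤ᵖli-T_ _≤ᵖld-T_ _≤ᵖs-li-T_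

_≤ᵖT_ : Language → Language → Set₁
A ≤ᵖT S = Σ[ M ∈ Machine ] (IsDPTM M × Decides M S A)

-- For every input x, there are no queries or the lengths of the queries
-- satisfy P (length x).
RestrictedReduction : (ℕ → List ℕ → Set) → Language → Language → Set₁
RestrictedReduction P A S = Σ[ M ∈ Machine ] (IsDPTM M × Decides M S A ×
  (∀ x {qs} → Queries M S x qs →
     qs ≡ [] ⊎ P (length x) (map length qs)))

_≤ᵖli-T_ : Language → Language → Set₁
_≤ᵖli-T_ = RestrictedReduction (λ _ ls → Linked _<_ ls)

_≤ᵖld-T_ : Language → Language → Set₁
_≤ᵖld-T_ = RestrictedReduction (λ _ ls → Linked _>_ ls)

_≤ᵖs-li-T_ : Language → Language → Set₁
_≤ᵖs-li-T_ = RestrictedReduction (λ n ls → Linked _<_ (n ∷ ls))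

{-# OPTIONS --safe #-}
module Submission where

-- A reduction M with running time p is simulated under a unary clock of
-- length p(n) + n + 2, next to a unary target length t.  Every simulated step
-- moves t by k, upwards for length-increasing and downwards for
-- length-decreasing reductions, and a query of M is replaced by σ(...σ(w)),
-- with σ applied until the length is at least t.  As σ adds between 1 and k
-- letters, the length lies in [t, t + k), so that the lengths for different
-- steps are ordered like the targets; t starts beyond all queries of M and
-- stays beyond them.  The clock makes the simulation halt in polynomial time
-- even if the answers it gets are those of no oracle for M, which can
-- happen when S is replaced by an oracle that σ does not preserve.
--
-- The simulating machine is written as a structured program over stacks: a
-- stack is the part of a tape to the right of the head, and a tape of M or of
-- the machine computing σ is a pair of stacks.

-- Membership in `S` need not be decidable, so the run of the simulation with oracle `S` cannot be
-- followed by evaluating the oracle. Everything is proved instead for an arbitrary list of oracle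
-- answers, given to `M` and to the simulator alike. Along one list both are deterministic, and
-- their logs differ only in that queried words are replaced by iterates of `σ`. As `σ` preserves
-- membership in `S` both ways, the list is right for one log exactly when it is right for the
-- other. Only at this point do the oracle and the languages enter. The additive bound `k` keeps the
-- lengths affordable: windows of constant width, one for each of polynomially many steps, fit into
-- a polynomial range, whereas growth by a constant factor at each step would compound to
-- exponential length. The upward and the downward version differ only in a `Strategy`. The reverse
-- implications forget the restriction on the queries.

open import Defs
open import Data.Bool.Base using (Bool; true; false; if_then_else_)
open import Data.Empty using (⊥-elim)
open import Data.Fin.Base using (Fin; zero; suc)
open import Data.Fin.Properties using (1↔⊤; 2↔Bool; +↔⊎; *↔×)
open import Data.List.Base using (List; []; _∷_; map; length; _++_; replicate; _ʳ++_)
open import Data.List.Properties using (length-reverse; ++-identityʳ; reverse-involutive)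
open import Data.List.Relation.Unary.Linked using (Linked; []; [-]; _∷_) renaming (tail to linked-tail)
open import Data.List.Relation.Unary.All using (All; []; _∷_)
open import Data.Maybe.Base using (Maybe; just; nothing)
open import Data.Nat.Base using (ℕ; zero; suc; _+_; _*_; _∸_; _≤_; _<_; _>_; z≤n; s≤s; z<s)
open import Data.Nat.Properties
open import Data.Nat.Tactic.RingSolver using (solve-∀)
open import Data.Product.Base using (Σ; ∃-syntax; _×_; _,_; proj₁; proj₂)
open import Data.Product.Function.Dependent.Propositional using () renaming (cong to Σ-cong)
open import Data.Product.Function.NonDependent.Propositional using (_×-cong_)
open import Data.Sum.Base using (_⊎_; inj₁; inj₂)
open import Data.Sum using (isInj₁; isInj₂)
open import Data.Sum.Function.Propositional using (_⊎-cong_)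
open import Data.Unit.Base using (⊤; tt)
open import Data.Vec.Base using (Vec; []; _∷_; head; tail; zipWith) renaming (map to mapᵛ; replicate to replicateᵛ; _++_ to _++ᵛ_; take to takeᵛ; drop to dropᵛ)
open import Data.Vec.Properties using (map-++; zipWith-++)
open import Data.Vec.Relation.Binary.Pointwise.Inductive using (Pointwise; []; _∷_)
open import Function.Base using (_∘_; id)
open import Function.Bundles using (_⇔_; _↔_; mk↔ₛ′; mk⇔; Equivalence; Inverse)
open import Function.Properties.Inverse using (↔-refl; ↔-sym; ↔-trans)
open import Relation.Binary.PropositionalEquality using (_≡_; refl; sym; trans; cong; cong₂; subst)
open import Relation.Unary using (_∈_; _∉_; ∅)

-- Finite types

instance
  ⊤-finite : IsFinite ⊤
  ⊤-finite = 1 , ↔-sym 1↔⊤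

  Bool-finite : IsFinite Bool
  Bool-finite = 2 , ↔-sym 2↔Bool

finite-resp : ∀ {A B} → A ↔ B → IsFinite B → IsFinite A
finite-resp A↔B (n , B↔n) = n , ↔-trans A↔B B↔n

⊎-finite : ∀ {A B} → IsFinite A → IsFinite B → IsFinite (A ⊎ B)
⊎-finite (m , A↔m) (n , B↔n) = m + n , ↔-trans (A↔m ⊎-cong B↔n) (↔-sym +↔⊎)

×-finite : ∀ {A B} → IsFinite A → IsFinite B → IsFinite (A × B)
×-finite (m , A↔m) (n , B↔n) = m * n , ↔-trans (A↔m ×-cong B↔n) (↔-sym *↔×)

Maybe-finite : ∀ {A} → IsFinite A → IsFinite (Maybe A)
Maybe-finite A-finite = finite-resp
  (mk↔ₛ′ (λ { nothing → inj₁ tt ; (just a) → inj₂ a })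
         (λ { (inj₁ tt) → nothing ; (inj₂ a) → just a })
         (λ { (inj₁ tt) → refl ; (inj₂ a) → refl })
         (λ { nothing → refl ; (just a) → refl }))
  (⊎-finite ⊤-finite A-finite)

Symbol-finite : ∀ {A} → IsFinite A → IsFinite (Symbol A)
Symbol-finite A-finite = finite-resp
  (mk↔ₛ′ (λ { blank → nothing ; (bit b) → just (inj₁ b) ; (aux a) → just (inj₂ a) })
         (λ { nothing → blank ; (just (inj₁ b)) → bit b ; (just (inj₂ a)) → aux a })
         (λ { nothing → refl ; (just (inj₁ b)) → refl ; (just (inj₂ a)) → refl })
         (λ { blank → refl ; (bit b) → refl ; (aux a) → refl }))
  (Maybe-finite (⊎-finite Bool-finite A-finite))

Vec-finite : ∀ {A} → IsFinite A → ∀ n → IsFinite (Vec A n)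
Vec-finite A-finite zero = finite-resp
  (mk↔ₛ′ (λ _ → tt) (λ _ → []) (λ _ → refl) (λ { [] → refl })) ⊤-finite
Vec-finite A-finite (suc n) = finite-resp
  (mk↔ₛ′ (λ v → head v , tail v) (λ (a , v) → a ∷ v)
         (λ _ → refl) (λ { (_ ∷ _) → refl }))
  (×-finite A-finite (Vec-finite A-finite n))

Σ-Fin-finite : ∀ n {B : Fin n → Set} → (∀ i → IsFinite (B i)) → IsFinite (Σ (Fin n) B)
Σ-Fin-finite zero    _        = 0 , mk↔ₛ′ (λ ()) (λ ()) (λ ()) (λ ())
Σ-Fin-finite (suc n) B-finite = finite-resp
  (mk↔ₛ′ (λ { (zero , b) → inj₁ b ; (suc i , b) → inj₂ (i , b) })
         (λ { (inj₁ b) → zero , b ; (inj₂ (i , b)) → suc i , b })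
         (λ { (inj₁ b) → refl ; (inj₂ (i , b)) → refl })
         (λ { (zero , b) → refl ; (suc i , b) → refl }))
  (⊎-finite (B-finite zero) (Σ-Fin-finite n (B-finite ∘ suc)))

-- The control positions after a branch depend on the value that selected it, so finiteness of the
-- state set of a compiled program needs dependent sums.
Σ-finite : ∀ {A} {B : A → Set} → IsFinite A → (∀ a → IsFinite (B a)) → IsFinite (Σ A B)
Σ-finite {A} {B} (n , A↔n) B-finite = finite-resp
  (↔-sym (Σ-cong {B = B} (↔-sym A↔n) ↔-refl))
  (Σ-Fin-finite n (λ i → B-finite (Inverse.from A↔n i)))

-- Polynomial bounds

infixl 6 _⊕_
infixl 7 _⊗_

_⊕_ : Polynomial → Polynomial → Polynomial
[]      ⊕ q       = q
(a ∷ p) ⊕ []      = a ∷ p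
(a ∷ p) ⊕ (b ∷ q) = a + b ∷ p ⊕ q

eval-⊕ : ∀ p q n → eval (p ⊕ q) n ≡ eval p n + eval q n
eval-⊕ []      q       n = refl
eval-⊕ (a ∷ p) []      n = sym (+-identityʳ _)
eval-⊕ (a ∷ p) (b ∷ q) n rewrite eval-⊕ p q n = lemma a b n (eval p n) (eval q n)
  where
  lemma : ∀ a b n u v → a + b + n * (u + v) ≡ a + n * u + (b + n * v)
  lemma = solve-∀

_⊗_ : Polynomial → Polynomial → Polynomial
[]      ⊗ q = []
(a ∷ p) ⊗ q = map (a *_) q ⊕ (0 ∷ p ⊗ q)

eval-scale : ∀ a q n → eval (map (a *_) q) n ≡ a * eval q n
eval-scale a []      n = sym (*-zeroʳ a)
eval-scale a (b ∷ q) n rewrite eval-scale a q n = lemma a b n (eval q n)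
  where
  lemma : ∀ a b n v → a * b + n * (a * v) ≡ a * (b + n * v)
  lemma = solve-∀

eval-⊗ : ∀ p q n → eval (p ⊗ q) n ≡ eval p n * eval q n
eval-⊗ []      q n = refl
eval-⊗ (a ∷ p) q n
  rewrite eval-⊕ (map (a *_) q) (0 ∷ p ⊗ q) n | eval-scale a q n | eval-⊗ p q n =
  lemma a n (eval p n) (eval q n)
  where
  lemma : ∀ a n u v → a * v + n * (u * v) ≡ (a + n * u) * v
  lemma = solve-∀

eval-mono : ∀ p {m n} → m ≤ n → eval p m ≤ eval p n
eval-mono []      m≤n = z≤n
eval-mono (a ∷ p) m≤n = +-monoʳ-≤ a (*-mono-≤ m≤n (eval-mono p m≤n))

-- An upper bound suffices for running times, and it lets costs be written as they arise from the
-- programs and be bounded only at the end.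
PolyBounded : (ℕ → ℕ) → Set
PolyBounded f = ∃[ p ] (∀ n → f n ≤ eval p n)

bounded-const : ∀ c → PolyBounded (λ _ → c)
bounded-const c = c ∷ [] , λ n → m≤m+n c (n * 0)

bounded-id : PolyBounded (λ n → n)
bounded-id = 0 ∷ 1 ∷ [] , λ n → ≤-reflexive (lemma n)
  where
  lemma : ∀ n → n ≡ n * (1 + n * 0)
  lemma = solve-∀

bounded-+ : ∀ {f g} → PolyBounded f → PolyBounded g → PolyBounded (λ n → f n + g n)
bounded-+ (p , f≤p) (q , g≤q) = p ⊕ q , λ n →
  ≤-trans (+-mono-≤ (f≤p n) (g≤q n)) (≤-reflexive (sym (eval-⊕ p q n)))

bounded-* : ∀ {f g} → PolyBounded f → PolyBounded g → PolyBounded (λ n → f n * g n)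
bounded-* (p , f≤p) (q , g≤q) = p ⊗ q , λ n →
  ≤-trans (*-mono-≤ (f≤p n) (g≤q n)) (≤-reflexive (sym (eval-⊗ p q n)))

-- Horner's rule reduces composition to sums and products, so that no composition of coefficient
-- lists has to be defined.
bounded-eval : ∀ p {f} → PolyBounded f → PolyBounded (λ n → eval p (f n))
bounded-eval []      _         = bounded-const 0
bounded-eval (a ∷ p) f-bounded =
  bounded-+ (bounded-const a) (bounded-* f-bounded (bounded-eval p f-bounded))

-- Computations along a given sequence of oracle answers

answer : List Bool → Bool
answer []      = false
answer (b ∷ _) = b

rest : {A : Set} → List A → List A
rest []       = []
rest (_ ∷ as) = as

Log : Set
Log = List (Word × Bool)

Correct : Language → Word × Bool → Set
Correct X (w , true)  = w ∈ X
Correct X (w , false) = w ∉ X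

open Configuration

module _ (M : Machine) where
  open Machine M

  -- The queries are answered by the list of answers, and by false once it is
  -- exhausted; no oracle has to agree with these answers.
  data Trace : Configuration M → List Bool → ℕ → Log → Configuration M → List Bool → Set where
    done : ∀ {c as} → Trace c as 0 [] c as
    step : ∀ {c as n log d as′ δ} → instruction (state c) ≡ move δ →
           Trace (perform M (δ (mapᵛ scanned (tapes c))) c) as n log d as′ →
           Trace c as (suc n) log d as′
    ask  : ∀ {c as n log d as′ q⁺ q⁻} → instruction (state c) ≡ query q⁺ q⁻ →
           Trace (config (if answer as then q⁺ else q⁻) (tapes c)) (rest as) n log d as′ →
           Trace c as (suc n) ((secondTapeWord M c , answer as) ∷ log) d as′

  -- The answers are read off the computation, which already contains the evidence for each of them;
  -- nothing about `X` is decided.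
  computation⇒trace : ∀ {X c n qs d} → Computation M X c n qs d →
    ∃[ as ] ∃[ log ] (Trace c as n log d [] × All (Correct X) log × map proj₁ log ≡ qs)
  computation⇒trace done = [] , [] , done , [] , refl
  computation⇒trace (step eq c) =
    let as , log , t , ok , qs = computation⇒trace c in as , log , step eq t , ok , qs
  computation⇒trace (yes eq w∈X c) =
    let as , log , t , ok , qs = computation⇒trace c in
    true ∷ as , _ , ask eq t , w∈X ∷ ok , cong (_ ∷_) qs
  computation⇒trace (no eq w∉X c) =
    let as , log , t , ok , qs = computation⇒trace c in
    false ∷ as , _ , ask eq t , w∉X ∷ ok , cong (_ ∷_) qs

  trace⇒computation : ∀ {X c as n log d as′} → Trace c as n log d as′ →
    All (Correct X) log → Computation M X c n (map proj₁ log) d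
  trace⇒computation done ok = done
  trace⇒computation (step eq t) ok = step eq (trace⇒computation t ok)
  -- The default answer of an exhausted list is logged like any other, so the log justifies it.
  trace⇒computation (ask {as = []} eq t) (w∉X ∷ ok) = no eq w∉X (trace⇒computation t ok)
  trace⇒computation (ask {as = true ∷ _} eq t) (w∈X ∷ ok) = yes eq w∈X (trace⇒computation t ok)
  trace⇒computation (ask {as = false ∷ _} eq t) (w∉X ∷ ok) = no eq w∉X (trace⇒computation t ok)

  -- The answers fix every step, so any trace along them is an initial part of one that halts. This
  -- turns a halting run into a time bound.
  trace-≤ : ∀ {c as n log d as′ m log′ e as″} → Trace c as n log d as′ → Halted M d →
    Trace c as m log′ e as″ → m ≤ n
  trace-≤ _ _ done = z≤n
  trace-≤ done (_ , h) (step eq _) with () ← trans (sym h) eq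
  trace-≤ done (_ , h) (ask eq _) with () ← trans (sym h) eq
  trace-≤ (step eq t) h (step eq′ u) with refl ← trans (sym eq) eq′ = s≤s (trace-≤ t h u)
  trace-≤ (step eq t) h (ask eq′ u) with () ← trans (sym eq) eq′
  trace-≤ (ask eq t) h (step eq′ u) with () ← trans (sym eq) eq′
  trace-≤ (ask eq t) h (ask eq′ u) with refl ← trans (sym eq) eq′ = s≤s (trace-≤ t h u)

  trace-unique : ∀ {c as n log d as′ m log′ e as″} → Trace c as n log d as′ → Halted M d →
    Trace c as m log′ e as″ → Halted M e → d ≡ e × log ≡ log′
  trace-unique done h done h′ = refl , refl
  trace-unique done (_ , h) (step eq _) _ with () ← trans (sym h) eq
  trace-unique done (_ , h) (ask eq _) _ with () ← trans (sym h) eq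
  trace-unique (step eq _) _ done (_ , h′) with () ← trans (sym h′) eq
  trace-unique (ask eq _) _ done (_ , h′) with () ← trans (sym h′) eq
  trace-unique (step eq t) h (step eq′ u) h′ with refl ← trans (sym eq) eq′ = trace-unique t h u h′
  trace-unique (step eq t) h (ask eq′ u) _ with () ← trans (sym eq) eq′
  trace-unique (ask eq t) h (step eq′ u) _ with () ← trans (sym eq) eq′
  trace-unique (ask eq t) h (ask eq′ u) h′ with refl ← trans (sym eq) eq′ =
    let d≡e , log≡ = trace-unique t h u h′ in d≡e , cong (_ ∷_) log≡

-- Stack programs and their compilation to machines

module StackProgram (Aux : Set) (work : ℕ) where

  Sym : Set
  Sym = Symbol Aux

  N : ℕ
  N = 2 + work

  data Act : Set where
    keep pop : Act
    push set : Sym → Act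
    setPush  : Sym → Sym → Act

  top : List Sym → Sym
  top []      = blank
  top (a ∷ _) = a

  letter : Sym → Maybe Bool
  letter (bit b) = just b
  letter _       = nothing

  applyAct : Act → List Sym → List Sym
  applyAct keep          s = s
  applyAct pop           s = rest s
  applyAct (push a)      s = a ∷ s
  applyAct (set a)       s = a ∷ rest s
  applyAct (setPush a b) s = b ∷ a ∷ rest s

  Store : Set
  Store = Vec (List Sym) N

  -- A value passed on by `bind` or `loop` becomes part of the control state of the compiled
  -- machine, hence the finiteness arguments.
  data Prog : Set → Set₁ where
    ret  : ∀ {A} → A → Prog A
    act  : ∀ {A} → (Vec Sym N → A × Vec Act N) → Prog A
    ask  : Prog Bool
    bind : ∀ {A B} {{_ : IsFinite B}} → Prog B → (B → Prog A) → Prog A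
    loop : ∀ {A B} {{_ : IsFinite B}} → (B → Prog (B ⊎ A)) → B → Prog A

  -- The number n is an upper bound on the number of machine steps.
  data Run : ∀ {A} → Prog A → Store → List Bool → ℕ → Log → A → Store → List Bool → Set₁ where
    ret   : ∀ {A} {a : A} {s as} → Run (ret a) s as 0 [] a s as
    act   : ∀ {A} {f : Vec Sym N → A × Vec Act N} {s as} →
            Run (act f) s as 2 [] (proj₁ (f (mapᵛ top s)))
                (zipWith applyAct (proj₂ (f (mapᵛ top s))) s) as
    ask   : ∀ {s as} → Run ask s as 1 ((leadingBits (head (tail s)) , answer as) ∷ [])
                           (answer as) s (rest as)
    bind  : ∀ {A B} {{B-finite : IsFinite B}} {p : Prog B} {f : B → Prog A}
              {s as m log b s′ as′ n log′ a s″ as″} →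
            Run p s as m log b s′ as′ → Run (f b) s′ as′ n log′ a s″ as″ →
            Run (bind p f) s as (m + suc n) (log ++ log′) a s″ as″
    again : ∀ {A B} {{B-finite : IsFinite B}} {f : B → Prog (B ⊎ A)}
              {b b′ s as m log s′ as′ n log′ a s″ as″} →
            Run (f b) s as m log (inj₁ b′) s′ as′ → Run (loop f b′) s′ as′ n log′ a s″ as″ →
            Run (loop f b) s as (m + suc n) (log ++ log′) a s″ as″
    leave : ∀ {A B} {{B-finite : IsFinite B}} {f : B → Prog (B ⊎ A)} {b s as m log a s′ as′} →
            Run (f b) s as m log (inj₂ a) s′ as′ → Run (loop f b) s as m log a s′ as′
    slack : ∀ {A} {p : Prog A} {s as m n log a s′ as′} → m ≤ n →
            Run p s as m log a s′ as′ → Run p s as n log a s′ as′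

  -- A flow graph with results at its exits: fragments are composed by redirecting the exits of one
  -- to the entry of the next.
  data Node (Q A : Set) : Set where
    exit  : A → Node Q A
    query : Q → Q → Node Q A
    move  : (Vec Sym N → Q × Vec (Sym × Direction) N) → Node Q A

  module _ {Q Q′ A B : Set} (h : Q → Q′) (k : A → Node Q′ B) where

    embed : Node Q A → Node Q′ B
    embed (exit a)    = k a
    embed (query y n) = query (h y) (h n)
    embed (move δ)    = move λ v → h (proj₁ (δ v)) , proj₂ (δ v)

  -- A jump rewrites the scanned symbols and moves no head. This single step is the `suc` in the
  -- costs of `bind` and `again`.
  goto : ∀ {Q A} → Q → Node Q A
  goto q = move λ v → q , mapᵛ (_, stay) v

  -- An act takes two machine steps: the second one completes the pushes.
  phase₁ phase₂ : Act → Sym → Sym × Direction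
  phase₁ keep          c = c , stay
  phase₁ pop           c = c , right
  phase₁ (push _)      c = c , left
  phase₁ (set a)       c = a , stay
  phase₁ (setPush a _) c = a , left
  phase₂ (push a)      c = a , stay
  phase₂ (setPush _ b) c = b , stay
  phase₂ _             c = c , stay

  -- For `act`, `nothing` is the entry. Afterwards the symbols seen on entry are remembered, because
  -- the pushes and the result depend on them while the first phase has already changed what the
  -- heads scan; the flag tells whether the second phase is over.
  Pos : ∀ {A} → Prog A → Set
  Pos (ret a)            = ⊤
  Pos (act f)            = Maybe (Bool × Vec Sym N)
  Pos ask                = Maybe Bool
  Pos (bind {B = B} p f) = Pos p ⊎ Σ B (λ b → Pos (f b))
  Pos (loop {B = B} f b) = Σ B (λ b → Pos (f b))

  Pos-finite : IsFinite Aux → ∀ {A} (p : Prog A) → IsFinite (Pos p)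
  Pos-finite _ (ret a) = ⊤-finite
  Pos-finite Aux-finite (act f) =
    Maybe-finite (×-finite Bool-finite (Vec-finite (Symbol-finite Aux-finite) N))
  Pos-finite _ ask = Maybe-finite Bool-finite
  Pos-finite Aux-finite (bind {{B-finite}} p f) =
    ⊎-finite (Pos-finite Aux-finite p) (Σ-finite B-finite λ b → Pos-finite Aux-finite (f b))
  Pos-finite Aux-finite (loop {{B-finite}} f b) = Σ-finite B-finite λ b → Pos-finite Aux-finite (f b)

  entry : ∀ {A} (p : Prog A) → Pos p
  entry (ret a)    = tt
  entry (act f)    = nothing
  entry ask        = nothing
  entry (bind p f) = inj₁ (entry p)
  entry (loop f b) = b , entry (f b)

  enter : ∀ {Q A B} (f : B → Prog A) → B → Node (Q ⊎ Σ B (λ b → Pos (f b))) A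
  enter f b = goto (inj₂ (b , entry (f b)))

  module _ {A B : Set} (f : B → Prog (B ⊎ A)) where

    continue : B ⊎ A → Node (Σ B (λ b → Pos (f b))) A
    continue (inj₁ b) = goto (b , entry (f b))
    continue (inj₂ a) = exit a

  instr : ∀ {A} (p : Prog A) → Pos p → Node (Pos p) A
  instr (ret a)    _                  = exit a
  instr (act f)    nothing            = move λ v → just (false , v) , zipWith phase₁ (proj₂ (f v)) v
  instr (act f)    (just (false , u)) = move λ v → just (true , u) , zipWith phase₂ (proj₂ (f u)) v
  instr (act f)    (just (true , u))  = exit (proj₁ (f u))
  instr ask        nothing            = query (just true) (just false)
  instr ask        (just b)           = exit b
  instr (bind p f) (inj₁ q)           = embed inj₁ (enter f) (instr p q)
  instr (bind p f) (inj₂ (b , q))     = embed (λ q → inj₂ (b , q)) exit (instr (f b) q)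
  instr (loop f _) (b , q)            = embed (b ,_) (continue f) (instr (f b) q)

  -- Paths through flow graphs and the correctness of compilation

  Tapes : Set
  Tapes = Vec (Tape Aux) N

  queryWord : Tapes → Word
  queryWord ts = tapeWord (head (tail ts))

  data Path {Q A : Set} (I : Q → Node Q A) :
       Q → Tapes → List Bool → ℕ → Log → Q → Tapes → List Bool → Set where
    done : ∀ {q ts as} → Path I q ts as 0 [] q ts as
    step : ∀ {q ts as n log q′ ts′ as′ δ} → I q ≡ move δ →
           Path I (proj₁ (δ (mapᵛ scanned ts)))
                  (zipWith writeShift (proj₂ (δ (mapᵛ scanned ts))) ts) as n log q′ ts′ as′ →
           Path I q ts as (suc n) log q′ ts′ as′
    ask  : ∀ {q ts as n log q′ ts′ as′ q⁺ q⁻} → I q ≡ query q⁺ q⁻ →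
           Path I (if answer as then q⁺ else q⁻) ts (rest as) n log q′ ts′ as′ →
           Path I q ts as (suc n) ((queryWord ts , answer as) ∷ log) q′ ts′ as′

  module _ {Q A : Set} {I : Q → Node Q A} where

    _++ᵖ_ : ∀ {q ts as m log q′ ts′ as′ n log′ q″ ts″ as″} →
      Path I q ts as m log q′ ts′ as′ → Path I q′ ts′ as′ n log′ q″ ts″ as″ →
      Path I q ts as (m + n) (log ++ log′) q″ ts″ as″
    done      ++ᵖ u = u
    step eq t ++ᵖ u = step eq (t ++ᵖ u)
    ask eq t  ++ᵖ u = ask eq (t ++ᵖ u)

    embed-path : ∀ {Q′ B} {I′ : Q′ → Node Q′ B} (h : Q → Q′) (k : A → Node Q′ B) →
      (∀ q → I′ (h q) ≡ embed h k (I q)) →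
      ∀ {q ts as n log q′ ts′ as′} → Path I q ts as n log q′ ts′ as′ →
      Path I′ (h q) ts as n log (h q′) ts′ as′
    embed-path h k eq done = done
    embed-path h k eq (step e t) =
      step (trans (eq _) (cong (embed h k) e)) (embed-path h k eq t)
    embed-path h k eq (ask {as = []} e t) =
      ask (trans (eq _) (cong (embed h k) e)) (embed-path h k eq t)
    embed-path h k eq (ask {as = true ∷ _} e t) =
      ask (trans (eq _) (cong (embed h k) e)) (embed-path h k eq t)
    embed-path h k eq (ask {as = false ∷ _} e t) =
      ask (trans (eq _) (cong (embed h k) e)) (embed-path h k eq t)

  -- The stack is the tape from the head to the right; the cells to the left
  -- of the head are garbage.
  Holds : List Sym → Tape Aux → Set
  Holds s t = ∃[ j ] (scanned t ∷ rights t ≡ s ++ replicate j blank)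

  Agree : Store → Tapes → Set
  Agree = Pointwise Holds

  top-scanned : ∀ {s t} → Holds s t → top s ≡ scanned t
  top-scanned {[]}    (suc j , refl) = refl
  top-scanned {a ∷ s} (j , refl)     = refl

  tops-scanned : ∀ {n} {s : Vec (List Sym) n} {ts} → Pointwise Holds s ts →
    mapᵛ top s ≡ mapᵛ scanned ts
  tops-scanned []                   = refl
  tops-scanned {ts = t ∷ _} (h ∷ hs) = cong₂ _∷_ (top-scanned {t = t} h) (tops-scanned hs)

  leadingBits-blanks : ∀ s j → leadingBits {Aux} (s ++ replicate j blank) ≡ leadingBits s
  leadingBits-blanks []          zero    = refl
  leadingBits-blanks []          (suc j) = refl
  leadingBits-blanks (blank ∷ s) j       = refl
  leadingBits-blanks (bit b ∷ s) j       = cong (b ∷_) (leadingBits-blanks s j)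
  leadingBits-blanks (aux a ∷ s) j       = refl

  holds-word : ∀ {s t} → Holds s t → leadingBits s ≡ tapeWord t
  holds-word {s} (j , eq) = sym (trans (cong leadingBits eq) (leadingBits-blanks s j))

  actTape : Act → Tape Aux → Tape Aux
  actTape x t = writeShift (phase₂ x (scanned t′)) t′
    where t′ = writeShift (phase₁ x (scanned t)) t

  shift-left : (t : Tape Aux) → rights (shift left t) ≡ scanned t ∷ rights t
  shift-left (tape []      a r) = refl
  shift-left (tape (_ ∷ _) a r) = refl

  act-holds : ∀ x {s t} → Holds s t → Holds (applyAct x s) (actTape x t)
  act-holds keep h = h
  -- The empty stack stands for blanks only: popping it moves the head to a further blank, a fresh
  -- one at the end of the tape.
  act-holds pop {[]} {tape l a []} (suc zero , refl) = 1 , refl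
  act-holds pop {[]} {tape l a (b ∷ r)} (suc (suc j) , refl) = suc j , refl
  act-holds pop {_ ∷ []} {tape l a []} (zero , refl) = 1 , refl
  act-holds pop {_ ∷ []} {tape l a (b ∷ r)} (suc j , refl) = suc j , refl
  act-holds pop {_ ∷ _ ∷ s} (j , refl) = j , refl
  act-holds (push b) {t = t} (j , eq) = j , cong (b ∷_) (trans (shift-left t) eq)
  act-holds (set b) {[]} (suc j , refl) = j , refl
  act-holds (set b) {_ ∷ s} (j , refl) = j , refl
  act-holds (setPush b c) {[]} {tape l _ r} (suc j , refl) =
    j , cong (c ∷_) (shift-left (tape l b r))
  act-holds (setPush b c) {_ ∷ s} {tape l _ r} (j , refl) =
    j , cong (c ∷_) (shift-left (tape l b r))

  acts-agree : ∀ {n} (xs : Vec Act n) {s ts} → Pointwise Holds s ts →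
    Pointwise Holds (zipWith applyAct xs s)
      (let ts′ = zipWith writeShift (zipWith phase₁ xs (mapᵛ scanned ts)) ts
       in zipWith writeShift (zipWith phase₂ xs (mapᵛ scanned ts′)) ts′)
  acts-agree []       []       = []
  acts-agree (x ∷ xs) (h ∷ hs) = act-holds x h ∷ acts-agree xs hs

  goto-tapes : ∀ {n} (ts : Vec (Tape Aux) n) →
    zipWith writeShift (mapᵛ (_, stay) (mapᵛ scanned ts)) ts ≡ ts
  goto-tapes []       = refl
  goto-tapes (t ∷ ts) = cong (t ∷_) (goto-tapes ts)

  goto-path : ∀ {Q A} {I : Q → Node Q A} {q q′ ts as n log q″ ts′ as′} → I q ≡ goto q′ →
    Path I q′ ts as n log q″ ts′ as′ → Path I q ts as (suc n) log q″ ts′ as′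
  goto-path {I = I} {q′ = q′} {ts} eq t =
    step eq (subst (λ ts → Path I q′ ts _ _ _ _ _ _) (sym (goto-tapes ts)) t)

  -- The path stops in front of an `exit` node, so that an enclosing fragment can redirect this node
  -- by `embed`. Because of `slack` the length of the path is only bounded by `n`.
  run-path : ∀ {A} {p : Prog A} {s as n log a s′ as′} → Run p s as n log a s′ as′ →
    ∀ {ts} → Agree s ts → ∃[ m ] ∃[ q ] ∃[ ts′ ]
    (m ≤ n × Path (instr p) (entry p) ts as m log q ts′ as′ × instr p q ≡ exit a × Agree s′ ts′)
  run-path ret h = _ , _ , _ , z≤n , done , refl , h
  run-path (act {f = f} {s}) {ts} h rewrite tops-scanned h =
    _ , _ , _ , ≤-refl , step refl (step refl done) , refl ,
    acts-agree (proj₂ (f (mapᵛ scanned ts))) h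
  run-path (ask {as = as}) {ts} h@(_ ∷ h₁ ∷ _) =
    _ , just (answer as) , ts , ≤-refl ,
    subst (λ w → Path (instr ask) nothing ts as 1 ((w , answer as) ∷ []) _ ts (rest as))
          (sym (holds-word {t = head (tail ts)} h₁)) (answered as) ,
    refl , h
    where
    answered : ∀ as → Path (instr ask) nothing ts as 1 ((queryWord ts , answer as) ∷ [])
                           (just (answer as)) ts (rest as)
    answered []          = ask refl done
    answered (true ∷ _)  = ask refl done
    answered (false ∷ _) = ask refl done
  run-path (bind {p = p} {f} {b = b} r r′) h =
    let m , q , ts , m≤ , t , eq , h′ = run-path r h
        n , q′ , ts′ , n≤ , t′ , eq′ , h″ = run-path r′ h′
    in m + suc n , _ , ts′ , +-mono-≤ m≤ (s≤s n≤) ,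
       embed-path inj₁ (enter f) (λ _ → refl) t ++ᵖ
         goto-path (cong (embed inj₁ (enter f)) eq)
                   (embed-path (λ q → inj₂ (b , q)) exit (λ _ → refl) t′) ,
       cong (embed (λ q → inj₂ (b , q)) exit) eq′ , h″
  run-path (again {f = f} {b} r r′) h =
    let m , q , ts , m≤ , t , eq , h′ = run-path r h
        n , q′ , ts′ , n≤ , t′ , eq′ , h″ = run-path r′ h′
    in m + suc n , _ , ts′ , +-mono-≤ m≤ (s≤s n≤) ,
       embed-path (b ,_) (continue f) (λ _ → refl) t ++ᵖ
         goto-path (cong (embed (b ,_) (continue f)) eq) t′ ,
       eq′ , h″
  run-path (leave {f = f} {b} r) h =
    let m , q , ts , m≤ , t , eq , h′ = run-path r h
    in m , _ , ts , m≤ , embed-path (b ,_) (continue f) (λ _ → refl) t ,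
       cong (embed (b ,_) (continue f)) eq , h′
  run-path (slack m≤n r) h =
    let m , q , ts , m≤ , t , eq , h′ = run-path r h
    in m , q , ts , ≤-trans m≤ m≤n , t , eq , h′

  -- From flow graphs to machines

  toInstruction : ∀ {Q} → Node Q Bool → Instruction Q Aux N
  toInstruction (exit b)    = halt b
  toInstruction (query y n) = query y n
  toInstruction (move δ)    = move δ

  compile : IsFinite Aux → Prog Bool → Machine
  compile Aux-finite p = record
    { State       = Pos p
    ; finiteState = Pos-finite Aux-finite p
    ; Aux         = Aux
    ; finiteAux   = Aux-finite
    ; work        = work
    ; start       = entry p
    ; instruction = λ q → toInstruction (instr p q)
    }

  path-trace : ∀ {Aux-finite} {p : Prog Bool} {q ts as n log q′ ts′ as′} →
    Path (instr p) q ts as n log q′ ts′ as′ →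
    Trace (compile Aux-finite p) (config q ts) as n log (config q′ ts′) as′
  path-trace done        = done
  path-trace (step eq t) = step (cong toInstruction eq) (path-trace t)
  path-trace (ask eq t)  = ask (cong toInstruction eq) (path-trace t)

  initialStore : Word → Store
  initialStore x = map bit x ∷ replicateᵛ (1 + work) []

  initial-agree : ∀ x → Agree (initialStore x) (wordTape x ∷ replicateᵛ (1 + work) emptyTape)
  initial-agree x = input x ∷ empties (1 + work)
    where
    input : ∀ x → Holds (map bit x) (wordTape x)
    input []      = 1 , refl
    input (b ∷ x) = 0 , cong (bit b ∷_) (sym (++-identityʳ _))
    empties : ∀ n → Pointwise Holds (replicateᵛ n []) (replicateᵛ n emptyTape)
    empties zero    = []
    empties (suc n) = (1 , refl) ∷ empties n

  compile-run : ∀ Aux-finite {p : Prog Bool} {x as n log b s as′} →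
    Run p (initialStore x) as n log b s as′ →
    ∃[ m ] ∃[ c ] (m ≤ n × Trace (compile Aux-finite p) (initial (compile Aux-finite p) x) as m log c as′ ×
                   HaltsWith (compile Aux-finite p) c b)
  compile-run Aux-finite {p} {x} r =
    let m , q , ts , m≤ , t , eq , _ = run-path r (initial-agree x)
    in m , config q ts , m≤ , path-trace t , cong toInstruction eq

-- Named registers

module _ {F : Set} where

  take-++ : ∀ {m n} (u : Vec F m) (v : Vec F n) → takeᵛ m (u ++ᵛ v) ≡ u
  take-++ []      v = refl
  take-++ (a ∷ u) v = cong (a ∷_) (take-++ u v)

  drop-++ : ∀ {m n} (u : Vec F m) (v : Vec F n) → dropᵛ m (u ++ᵛ v) ≡ v
  drop-++ []      v = refl
  drop-++ (a ∷ u) v = drop-++ u v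

  replicate-++ : ∀ m n {a : F} → replicateᵛ m a ++ᵛ replicateᵛ n a ≡ replicateᵛ (m + n) a
  replicate-++ zero    n = refl
  replicate-++ (suc m) n = cong (_ ∷_) (replicate-++ m n)

Bank : Set → ℕ → Set
Bank F n = Vec F n × Vec F n

module _ {F : Set} where

  join : ∀ {m n} → Vec F m × Vec F n → Vec F (m + n)
  join (u , v) = u ++ᵛ v

  split : ∀ m {n} → Vec F (m + n) → Vec F m × Vec F n
  split m u = takeᵛ m u , dropᵛ m u

  split-join : ∀ {m n} (u : Vec F m) (v : Vec F n) → split m (u ++ᵛ v) ≡ (u , v)
  split-join u v = cong₂ _,_ (take-++ u v) (drop-++ u v)

-- The first two registers are the input tape and the query tape.  A bank
-- holds the stacks to the left and to the right of each head of a simulated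
-- machine.
module Registers (Aux : Set) (t₁ t₂ : ℕ) where

  open StackProgram Aux (4 + ((t₁ + t₁) + (t₂ + t₂)))

  record Shape (F : Set) : Set where
    constructor shape
    field
      regX regQ regY regV regC regT : F
      bank₁ : Bank F t₁
      bank₂ : Bank F t₂

  open Shape public

  flat : ∀ {F} → Shape F → Vec F N
  flat (shape x q y v c t b₁ b₂) =
    x ∷ q ∷ y ∷ v ∷ c ∷ t ∷ join (join b₁ , join b₂)

  unflat : ∀ {F} → Vec F N → Shape F
  unflat (x ∷ q ∷ y ∷ v ∷ c ∷ t ∷ bs) =
    shape x q y v c t (split t₁ (takeᵛ (t₁ + t₁) bs)) (split t₂ (dropᵛ (t₁ + t₁) bs))

  State : Set
  State = Shape (List Sym)

  tops : State → Shape Sym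
  tops (shape x q y v c t (l₁ , r₁) (l₂ , r₂)) =
    shape (top x) (top q) (top y) (top v) (top c) (top t)
          (mapᵛ top l₁ , mapᵛ top r₁) (mapᵛ top l₂ , mapᵛ top r₂)

  unflat-tops : ∀ s → unflat (mapᵛ top (flat s)) ≡ tops s
  unflat-tops (shape x q y v c t (l₁ , r₁) (l₂ , r₂))
    rewrite map-++ top (l₁ ++ᵛ r₁) (l₂ ++ᵛ r₂)
          | take-++ (mapᵛ top (l₁ ++ᵛ r₁)) (mapᵛ top (l₂ ++ᵛ r₂))
          | drop-++ (mapᵛ top (l₁ ++ᵛ r₁)) (mapᵛ top (l₂ ++ᵛ r₂))
          | map-++ top l₁ r₁ | map-++ top l₂ r₂
          | split-join (mapᵛ top l₁) (mapᵛ top r₁) | split-join (mapᵛ top l₂) (mapᵛ top r₂) = refl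

  -- An untouched bank is marked by nothing, so that its stacks are unchanged
  -- by computation rather than by a lemma.
  record Acts : Set where
    constructor mkActs
    field
      actX actQ actY actV actC actT : Act
      acts₁ : Maybe (Bank Act t₁)
      acts₂ : Maybe (Bank Act t₂)

  open Acts public

  keepAll : Acts
  keepAll = mkActs keep keep keep keep keep keep nothing nothing

  bankActs : ∀ {n} → Maybe (Bank Act n) → Bank Act n
  bankActs nothing  = replicateᵛ _ keep , replicateᵛ _ keep
  bankActs (just a) = a

  applyBank : ∀ {n} → Maybe (Bank Act n) → Bank (List Sym) n → Bank (List Sym) n
  applyBank nothing          b       = b
  applyBank (just (al , ar)) (l , r) = zipWith applyAct al l , zipWith applyAct ar r

  flatActs : Acts → Vec Act N
  flatActs (mkActs x q y v c t b₁ b₂) =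
    flat (shape x q y v c t (bankActs b₁) (bankActs b₂))

  apply : Acts → State → State
  apply (mkActs x q y v c t b₁ b₂) s = shape
    (applyAct x (regX s)) (applyAct q (regQ s)) (applyAct y (regY s))
    (applyAct v (regV s)) (applyAct c (regC s)) (applyAct t (regT s))
    (applyBank b₁ (bank₁ s)) (applyBank b₂ (bank₂ s))

  keep-all : ∀ {n} (s : Vec (List Sym) n) → zipWith applyAct (replicateᵛ n keep) s ≡ s
  keep-all []      = refl
  keep-all (a ∷ s) = cong (a ∷_) (keep-all s)

  bank-flat : ∀ {n} (a : Maybe (Bank Act n)) (b : Bank (List Sym) n) →
    zipWith applyAct (join (bankActs a)) (join b) ≡ join (applyBank a b)
  bank-flat nothing (l , r)
    rewrite zipWith-++ applyAct (replicateᵛ _ keep) (replicateᵛ _ keep) l r | keep-all l | keep-all r = refl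
  bank-flat (just (al , ar)) (l , r) = zipWith-++ applyAct al ar l r

  apply-flat : ∀ a s → zipWith applyAct (flatActs a) (flat s) ≡ flat (apply a s)
  apply-flat (mkActs x q y v c t a₁ a₂) s
    rewrite zipWith-++ applyAct (join (bankActs a₁)) (join (bankActs a₂)) (join (bank₁ s)) (join (bank₂ s))
          | bank-flat a₁ (bank₁ s) | bank-flat a₂ (bank₂ s) = refl

  -- The record keeps the structured states as indices, whereas `Run` mentions only their
  -- flattenings, from which they are awkward to infer.
  record Exec {A : Set} (p : Prog A) (s : State) (as : List Bool) (n : ℕ) (log : Log)
              (a : A) (s′ : State) (as′ : List Bool) : Set₁ where
    constructor exec
    field run : Run p (flat s) as n log a (flat s′) as′

  open Exec public

  opaque

    acts : ∀ {A} → (Shape Sym → A × Acts) → Prog A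
    acts f = act λ v → proj₁ (f (unflat v)) , flatActs (proj₂ (f (unflat v)))

    exec-acts : ∀ {A} {f : Shape Sym → A × Acts} {s as} →
      Exec (acts f) s as 2 [] (proj₁ (f (tops s))) (apply (proj₂ (f (tops s))) s) as
    exec-acts {f = f} {s} {as} = exec
      (subst (λ u → Run (acts f) (flat s) as 2 [] (proj₁ (f (tops s))) u as)
        (apply-flat (proj₂ (f (tops s))) s)
        (subst (λ v → Run (acts f) (flat s) as 2 [] (proj₁ (f v))
                          (zipWith applyAct (flatActs (proj₂ (f v))) (flat s)) as)
               (unflat-tops s) act))

  exec-ret : ∀ {A} {a : A} {s as} → Exec (ret a) s as 0 [] a s as
  exec-ret = exec ret

  exec-ask : ∀ {s as} →
    Exec ask s as 1 ((leadingBits (regQ s) , answer as) ∷ []) (answer as) s (rest as)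
  exec-ask = exec ask

  exec-bind : ∀ {A B} {{_ : IsFinite B}} {p : Prog B} {f : B → Prog A}
    {s as m log b s′ as′ n log′ a s″ as″} →
    Exec p s as m log b s′ as′ → Exec (f b) s′ as′ n log′ a s″ as″ →
    Exec (bind p f) s as (m + suc n) (log ++ log′) a s″ as″
  exec-bind (exec r) (exec r′) = exec (bind r r′)

  exec-again : ∀ {A B} {{_ : IsFinite B}} {f : B → Prog (B ⊎ A)}
    {b b′ s as m log s′ as′ n log′ a s″ as″} →
    Exec (f b) s as m log (inj₁ b′) s′ as′ → Exec (loop f b′) s′ as′ n log′ a s″ as″ →
    Exec (loop f b) s as (m + suc n) (log ++ log′) a s″ as″
  exec-again (exec r) (exec r′) = exec (again r r′)

  exec-leave : ∀ {A B} {{_ : IsFinite B}} {f : B → Prog (B ⊎ A)} {b s as m log a s′ as′} →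
    Exec (f b) s as m log (inj₂ a) s′ as′ → Exec (loop f b) s as m log a s′ as′
  exec-leave (exec r) = exec (leave r)

  exec-slack : ∀ {A} {p : Prog A} {s as m n log a s′ as′} → m ≤ n →
    Exec p s as m log a s′ as′ → Exec p s as n log a s′ as′
  exec-slack m≤n (exec r) = exec (slack m≤n r)

  exec-cost : ∀ {A} {p : Prog A} {s as m n log a s′ as′} → m ≡ n →
    Exec p s as m log a s′ as′ → Exec p s as n log a s′ as′
  exec-cost refl r = r

  exec-prog : ∀ {A} {p p′ : Prog A} {s as n log a s′ as′} → p ≡ p′ →
    Exec p s as n log a s′ as′ → Exec p′ s as n log a s′ as′
  exec-prog refl r = r

  exec-to : ∀ {A} {p : Prog A} {s as n log a s′ s″ as′} → s′ ≡ s″ →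
    Exec p s as n log a s′ as′ → Exec p s as n log a s″ as′
  exec-to refl r = r

  initialState : Word → State
  initialState x = shape (map bit x) [] [] [] [] []
    (replicateᵛ t₁ [] , replicateᵛ t₁ []) (replicateᵛ t₂ [] , replicateᵛ t₂ [])

  initial-flat : ∀ x → flat (initialState x) ≡ initialStore x
  initial-flat x
    rewrite replicate-++ {List Sym} t₁ t₁ {[]} | replicate-++ {List Sym} t₂ t₂ {[]}
          | replicate-++ {List Sym} (t₁ + t₁) (t₂ + t₂) {[]} = refl

-- Simulating a machine on a bank of stacks

module Marker (E : Set) (work : ℕ) where

  open StackProgram (Maybe E) work

  -- The bottom marker separates a simulated tape, blank beyond its end, from
  -- the garbage that earlier simulations have left below it.
  bottom : Sym
  bottom = aux nothing

  refillAct : Sym → Act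
  refillAct (aux nothing) = push blank
  refillAct _             = keep

module Simulation (E : Set) (work : ℕ) {K-Aux : Set}
  (ι : K-Aux → E) (π : E → Maybe K-Aux) (π-ι : ∀ a → π (ι a) ≡ just a) where

  open StackProgram (Maybe E) work
  open Marker E work

  encode : Symbol K-Aux → Sym
  encode blank   = blank
  encode (bit b) = bit b
  encode (aux a) = aux (just (ι a))

  fromMaybe : Maybe K-Aux → Symbol K-Aux
  fromMaybe nothing  = blank
  fromMaybe (just a) = aux a

  -- The values at the marker and at symbols of the other machine are defaults: `Exact` ensures that
  -- only encoded symbols are decoded.
  decode : Sym → Symbol K-Aux
  decode blank          = blank
  decode (bit b)        = bit b
  decode (aux nothing)  = blank
  decode (aux (just e)) = fromMaybe (π e)

  decode-encode : ∀ a → decode (encode a) ≡ a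
  decode-encode blank   = refl
  decode-encode (bit b) = refl
  decode-encode (aux a) = cong fromMaybe (π-ι a)

  Stacked : List (Symbol K-Aux) → List Sym → Set
  Stacked l s = ∃[ j ] (s ≡ map encode l ++ bottom ∷ j)

  KTape : Set
  KTape = Tape K-Aux

  -- An act sees only the top of a stack before popping it. After a move to the right, the marker
  -- may therefore lie where the simulated head scans a blank; `Loose` admits this, and a refill
  -- restores `Exact`.
  Exact Loose : KTape → List Sym → List Sym → Set
  Exact t l r = Stacked (lefts t) l × Stacked (scanned t ∷ rights t) r
  Loose t l r = Stacked (lefts t) l ×
    (Stacked (scanned t ∷ rights t) r ⊎ (scanned t ≡ blank × rights t ≡ [] × Stacked [] r))

  moveActs : Sym → Symbol K-Aux × Direction → Act × Act
  moveActs l             (a , stay)  = keep , set (encode a)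
  moveActs l             (a , right) = push (encode a) , pop
  -- The marker on the left stack means that the head leaves the stored part of the tape: the marker
  -- stays, and the newly scanned blank is supplied.
  moveActs (aux nothing) (a , left)  = keep , setPush (encode a) blank
  moveActs l             (a , left)  = pop , setPush (encode a) l

  move-loose : ∀ t {l r} → Exact t l r → ∀ x →
    Loose (writeShift x t) (applyAct (proj₁ (moveActs (top l) x)) l)
                           (applyAct (proj₂ (moveActs (top l) x)) r)
  move-loose (tape ls c rs)       (L , (j , refl))    (a , stay)  = L , inj₁ (j , refl)
  move-loose (tape ls c [])       ((i , refl) , R)    (a , right) =
    (i , refl) , inj₂ (refl , refl , (proj₁ R , cong rest (proj₂ R)))
  move-loose (tape ls c (b ∷ rs)) ((i , refl) , R)    (a , right) =
    (i , refl) , inj₁ (proj₁ R , cong rest (proj₂ R))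
  move-loose (tape [] c rs)            ((i , refl) , (j , refl)) (a , left) =
    (i , refl) , inj₁ (j , refl)
  move-loose (tape (blank ∷ ls) c rs)  ((i , refl) , (j , refl)) (a , left) =
    (i , refl) , inj₁ (j , refl)
  move-loose (tape (bit b ∷ ls) c rs)  ((i , refl) , (j , refl)) (a , left) =
    (i , refl) , inj₁ (j , refl)
  move-loose (tape (aux b ∷ ls) c rs)  ((i , refl) , (j , refl)) (a , left) =
    (i , refl) , inj₁ (j , refl)

  refill-exact : ∀ {t l r} → Loose t l r → Exact t l (applyAct (refillAct (top r)) r)
  refill-exact {tape _ blank   _} (L , inj₁ (j , refl)) = L , (j , refl)
  refill-exact {tape _ (bit b) _} (L , inj₁ (j , refl)) = L , (j , refl)
  refill-exact {tape _ (aux a) _} (L , inj₁ (j , refl)) = L , (j , refl)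
  refill-exact (L , inj₂ (refl , refl , (j , refl))) = L , (j , refl)

  data Bankwise (P : KTape → List Sym → List Sym → Set) :
       ∀ {n} → Vec KTape n → Vec (List Sym) n → Vec (List Sym) n → Set where
    []  : Bankwise P [] [] []
    _∷_ : ∀ {n t l r} {ts : Vec KTape n} {ls rs} → P t l r → Bankwise P ts ls rs →
          Bankwise P (t ∷ ts) (l ∷ ls) (r ∷ rs)

  module _ {n : ℕ} {Q : Set}
    (δ : Vec (Symbol K-Aux) n → Q × Vec (Symbol K-Aux × Direction) n) where

    simulateMove : Bank Sym n → Q × Bank Act n
    simulateMove (l , r) =
      proj₁ (δ (mapᵛ decode r)) ,
      zipWith (λ l x → proj₁ (moveActs l x)) l (proj₂ (δ (mapᵛ decode r))) ,
      zipWith (λ l x → proj₂ (moveActs l x)) l (proj₂ (δ (mapᵛ decode r)))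

  decode-tops : ∀ {n} {ts : Vec KTape n} {l r} → Bankwise Exact ts l r →
    mapᵛ decode (mapᵛ top r) ≡ mapᵛ scanned ts
  decode-tops []                                       = refl
  decode-tops {ts = t ∷ _} ((_ , (_ , refl)) ∷ bs) =
    cong₂ _∷_ (decode-encode (scanned t)) (decode-tops bs)

  moves-loose : ∀ {n} {ts : Vec KTape n} {l r} → Bankwise Exact ts l r → ∀ xs →
    Bankwise Loose (zipWith writeShift xs ts)
      (zipWith applyAct (zipWith (λ l x → proj₁ (moveActs l x)) (mapᵛ top l) xs) l)
      (zipWith applyAct (zipWith (λ l x → proj₂ (moveActs l x)) (mapᵛ top l) xs) r)
  moves-loose []                    []       = []
  moves-loose {ts = t ∷ _} (b ∷ bs) (x ∷ xs) = move-loose t b x ∷ moves-loose bs xs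

  refills-exact : ∀ {n} {ts : Vec KTape n} {l r} → Bankwise Loose ts l r →
    Bankwise Exact ts l (zipWith applyAct (mapᵛ refillAct (mapᵛ top r)) r)
  refills-exact []                    = []
  refills-exact {ts = t ∷ _} (b ∷ bs) = refill-exact {t} b ∷ refills-exact bs

  encode-bits : ∀ w → map encode (map bit w) ≡ map bit w
  encode-bits []      = refl
  encode-bits (b ∷ w) = cong (bit b ∷_) (encode-bits w)

  word-loose : ∀ w i j → Loose (wordTape w) (bottom ∷ i) (map bit w ++ bottom ∷ j)
  word-loose []      i j = (i , refl) , inj₂ (refl , refl , (j , refl))
  word-loose (b ∷ w) i j =
    (i , refl) , inj₁ (j , cong (λ s → bit b ∷ s ++ bottom ∷ j) (sym (encode-bits w)))

  empties-loose : ∀ {n} (l r : Vec (List Sym) n) →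
    Bankwise Loose (replicateᵛ n emptyTape) (zipWith applyAct (replicateᵛ n (push bottom)) l)
                   (zipWith applyAct (replicateᵛ n (push bottom)) r)
  empties-loose []      []      = []
  empties-loose (i ∷ l) (j ∷ r) = word-loose [] i j ∷ empties-loose l r

  -- After its letters a simulated word is followed by a blank, an auxiliary symbol or the marker,
  -- so draining it stops there and leaves the remainder `r` intact.
  word-letters : ∀ {s c} → Stacked s c →
    ∃[ r ] (c ≡ map bit (leadingBits s) ++ r × letter (top r) ≡ nothing)
  word-letters {[]}        (_ , refl) = _ , refl , refl
  word-letters {blank ∷ s} (_ , refl) = _ , refl , refl
  word-letters {aux a ∷ s} (_ , refl) = _ , refl , refl
  word-letters {bit b ∷ s} (j , refl) =
    let r , eq , no-letter = word-letters {s} (j , refl) in r , cong (bit b ∷_) eq , no-letter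

-- Moving words between registers and evaluating polynomials in unary

module Control (Aux : Set) (t₁ t₂ : ℕ) where

  open StackProgram Aux (4 + ((t₁ + t₁) + (t₂ + t₂))) public
  open Registers Aux t₁ t₂ public

  drainStep : (Bool → Acts) → Maybe Bool → (⊤ ⊎ ⊤) × Acts
  drainStep f (just b) = inj₁ tt , f b
  drainStep f nothing  = inj₂ tt , keepAll

  drain : (Shape Sym → Sym) → (Bool → Acts) → Prog ⊤
  drain source f = loop (λ _ → acts λ v → drainStep f (letter (source v))) tt

  -- In the state G u w the word w remains to be read from the source and the
  -- reversal of u has been read.
  drain-exec : ∀ {source f} (G : Word → Word → State) →
    (∀ u b w → letter (source (tops (G u (b ∷ w)))) ≡ just b) →
    (∀ u b w → apply (f b) (G u (b ∷ w)) ≡ G (b ∷ u) w) →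
    (∀ u → letter (source (tops (G u []))) ≡ nothing) →
    ∀ u w {as} → Exec (drain source f) (G u w) as (2 + length w * 3) [] tt (G (w ʳ++ u) []) as
  drain-exec {source} {f} G reads moves ends u [] {as} =
    exec-leave (subst (λ r → Exec (acts λ v → drainStep f (letter (source v))) (G u []) as 2 []
                             (proj₁ r) (apply (proj₂ r) (G u [])) as)
                 (cong (drainStep f) (ends u)) exec-acts)
  drain-exec {source} {f} G reads moves ends u (b ∷ w) {as} =
    exec-again (subst (λ s → Exec (acts λ v → drainStep f (letter (source v))) (G u (b ∷ w)) as 2 []
                             (inj₁ tt) s as)
                 (moves u b w)
                 (subst (λ r → Exec (acts λ v → drainStep f (letter (source v))) (G u (b ∷ w)) as 2 []
                                    (proj₁ r) (apply (proj₂ r) (G u (b ∷ w))) as)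
                        (cong (drainStep f) (reads u b w)) exec-acts))
          (drain-exec G reads moves ends (b ∷ u) w)

  ʳ++-involutive : ∀ (w : Word) → (w ʳ++ []) ʳ++ [] ≡ w
  ʳ++-involutive = reverse-involutive

  length-ʳ++ : ∀ (w u : Word) → length (w ʳ++ u) ≡ length w + length u
  length-ʳ++ []      u = refl
  length-ʳ++ (b ∷ w) u = trans (length-ʳ++ w (b ∷ u)) (+-suc (length w) (length u))

  one : Sym
  one = bit true

  X→YC Y→X C→V V→T V→C V⁺ : Prog ⊤
  X→YC = drain regX λ b → record keepAll { actX = pop ; actY = push (bit b) ; actC = push (bit b) }
  Y→X  = drain regY λ b → record keepAll { actY = pop ; actX = push (bit b) }
  C→V  = drain regC λ b → record keepAll { actC = pop ; actV = push (bit b) }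
  V→T  = drain regV λ b → record keepAll { actV = pop ; actT = push (bit b) }
  V→C  = drain regV λ b → record keepAll { actV = pop ; actC = push (bit b) }
  V⁺   = acts λ _ → tt , record keepAll { actV = push one }

  popV : Maybe Bool → Bool × Acts
  popV (just _) = true , record keepAll { actV = pop }
  popV nothing  = false , keepAll

  -- A round moves X to Y and back, adding the length of X to C on the way. One round for each
  -- letter of V yields the product of the lengths.
  addMultiple : Bool → Prog (⊤ ⊎ ⊤)
  addMultiple false = ret (inj₂ tt)
  addMultiple true  = bind X→YC λ _ → bind Y→X λ _ → ret (inj₁ tt)

  rounds : Prog ⊤
  rounds = loop (λ _ → bind (acts λ v → popV (letter (regV v))) addMultiple) tt

  multiply : Prog ⊤
  multiply = bind rounds λ _ → C→V

  addConstant : ℕ → Prog ⊤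
  addConstant zero    = ret tt
  addConstant (suc a) = bind V⁺ λ _ → addConstant a

  -- Numbers are unary: only the length of V counts, and its letters are remnants of the input.
  horner : Polynomial → Prog ⊤
  horner []      = ret tt
  horner (a ∷ p) = bind (horner p) λ _ → bind multiply λ _ → addConstant a

  roundCost : ℕ → ℕ
  roundCost n = 3 + (2 + n * 3 + suc (2 + n * 3 + 1))

  multiplyCost : ℕ → ℕ → ℕ
  multiplyCost n v = 3 + v * suc (roundCost n) + suc (2 + n * v * 3)

  hornerCost : Polynomial → ℕ → ℕ
  hornerCost []      n = 0
  hornerCost (a ∷ p) n = hornerCost p n + suc (multiplyCost n (eval p n) + suc (a * 3))

  module _ (q : List Sym) (b₁ : Bank (List Sym) t₁) (b₂ : Bank (List Sym) t₂) where

    words : Word → Word → Word → Word → Word → State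
    words x y v c t = shape (map bit x) q (map bit y) (map bit v) (map bit c) (map bit t) b₁ b₂

    module _ {x : Word} {t : Word} {as : List Bool} where

      round-exec : ∀ v c → Exec (addMultiple true) (words x [] v c t) as
        (2 + length x * 3 + suc (2 + length x * 3 + 1)) [] (inj₁ tt)
        (words x [] v (x ʳ++ c) t) as
      round-exec v c = exec-slack (+-monoʳ-≤ (2 + length x * 3) (s≤s (≤-reflexive (lemma (length (x ʳ++ [])) (length x)
                                  (trans (length-ʳ++ x []) (+-identityʳ _))))))
        (exec-bind (XYC [] x)
              (exec-bind (exec-to (cong (λ z → words z [] v (x ʳ++ c) t) (ʳ++-involutive x))
                           (drain-exec (λ u w → words u w v (x ʳ++ c) t)
                              (λ _ _ _ → refl) (λ _ _ _ → refl) (λ _ → refl) [] (x ʳ++ [])))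
                    exec-ret))
        where
        lemma : ∀ a b → a ≡ b → 2 + a * 3 + 1 ≡ 2 + b * 3 + 1
        lemma _ _ refl = refl
        XYC : ∀ u w → Exec X→YC (words w u v (u ++ c) t) as (2 + length w * 3) [] tt
                           (words [] (w ʳ++ u) v (w ʳ++ u ++ c) t) as
        XYC u w = exec-to (cong (λ z → words [] (w ʳ++ u) v z t) (lemma′ w u))
          (drain-exec (λ u w → words w u v (u ++ c) t)
             (λ _ _ _ → refl) (λ _ _ _ → refl) (λ _ → refl) u w)
          where
          lemma′ : ∀ w u → (w ʳ++ u) ++ c ≡ w ʳ++ u ++ c
          lemma′ []      u = refl
          lemma′ (b ∷ w) u = lemma′ w (b ∷ u)

      rounds-exec : ∀ v c → ∃[ c′ ] (length c′ ≡ length x * length v + length c ×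
        Exec rounds (words x [] v c t) as (3 + length v * suc (roundCost (length x))) [] tt
             (words x [] [] c′ t) as)
      rounds-exec [] c = c , cong (_+ length c) (sym (*-zeroʳ (length x))) ,
        exec-leave (exec-bind exec-acts exec-ret)
      rounds-exec (b ∷ v) c =
        let c′ , eq , r = rounds-exec v (x ʳ++ c)
        in c′ , trans eq (lemma (length x) (length v) (length c) _ (length-ʳ++ x c)) ,
           exec-slack (≤-reflexive (lemma′ (roundCost (length x)) (length v * suc (roundCost (length x)))))
                 (exec-again (exec-bind exec-acts (round-exec v c)) r)
        where
        lemma : ∀ n v c m → m ≡ n + c → n * v + m ≡ n * suc v + c
        lemma n v c _ refl = solve n v c
          where
          solve : ∀ n v c → n * v + (n + c) ≡ n * suc v + c
          solve = solve-∀
        lemma′ : ∀ r m → r + suc (3 + m) ≡ 3 + (suc r + m)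
        lemma′ = solve-∀

      multiply-exec : ∀ v → ∃[ v′ ] (length v′ ≡ length x * length v ×
        Exec multiply (words x [] v [] t) as (multiplyCost (length x) (length v)) [] tt
             (words x [] v′ [] t) as)
      multiply-exec v =
        let c , eq , r = rounds-exec v []
            eq′ = trans eq (+-identityʳ _)
        in c ʳ++ [] , trans (length-ʳ++ c []) (trans (+-identityʳ _) eq′) ,
           exec-cost (cong (λ m → 3 + length v * suc (roundCost (length x)) + suc (2 + m * 3)) eq′)
                 (exec-bind r (drain-exec (λ u w → words x [] u w t)
                            (λ _ _ _ → refl) (λ _ _ _ → refl) (λ _ → refl) [] c))

      addConstant-exec : ∀ a v → ∃[ v′ ] (length v′ ≡ a + length v ×
        Exec (addConstant a) (words x [] v [] t) as (a * 3) [] tt (words x [] v′ [] t) as)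
      addConstant-exec zero    v = v , refl , exec-ret
      addConstant-exec (suc a) v =
        let v′ , eq , r = addConstant-exec a (true ∷ v)
        in v′ , trans eq (+-suc a (length v)) , exec-bind exec-acts r

      horner-exec : ∀ p → ∃[ v ] (length v ≡ eval p (length x) ×
        Exec (horner p) (words x [] [] [] t) as (hornerCost p (length x)) [] tt
             (words x [] v [] t) as)
      horner-exec []      = [] , refl , exec-ret
      horner-exec (a ∷ p) =
        let v , eq , r = horner-exec p
            v′ , eq′ , r′ = multiply-exec v
            v″ , eq″ , r″ = addConstant-exec a v′
        in v″ , trans eq″ (cong (a +_) (trans eq′ (cong (length x *_) eq))) ,
           exec-bind r (exec-bind (exec-cost (cong (multiplyCost (length x)) eq) r′) r″)

  roundCost-bounded : PolyBounded roundCost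
  roundCost-bounded = bounded-+ (bounded-const 3) (bounded-+ side
    (bounded-+ (bounded-const 1) (bounded-+ side (bounded-const 1))))
    where
    side : PolyBounded (λ n → 2 + n * 3)
    side = bounded-+ (bounded-const 2) (bounded-* bounded-id (bounded-const 3))

  hornerCost-bounded : ∀ p → PolyBounded (hornerCost p)
  hornerCost-bounded []      = bounded-const 0
  hornerCost-bounded (a ∷ p) = bounded-+ (hornerCost-bounded p) (bounded-+ (bounded-const 1) (bounded-+
    (bounded-+ (bounded-+ (bounded-const 3) (bounded-* value (bounded-+ (bounded-const 1) roundCost-bounded)))
               (bounded-+ (bounded-const 3) (bounded-* (bounded-* bounded-id value) (bounded-const 3))))
    (bounded-const (suc (a * 3)))))
    where
    value : PolyBounded (eval p)
    value = bounded-eval p bounded-id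

-- Operating the two simulated machines

module Simulators (M K : Machine) where

  private
    module M = Machine M
    module K = Machine K

  E : Set
  E = M.Aux ⊎ K.Aux

  E-finite : IsFinite (Maybe E)
  E-finite = Maybe-finite (⊎-finite M.finiteAux K.finiteAux)

  tM tK : ℕ
  tM = 2 + M.work
  tK = 2 + K.work

  open Control (Maybe E) tM tK public

  module SM = Simulation E (4 + ((tM + tM) + (tK + tK))) {M.Aux} inj₁ isInj₁ (λ _ → refl)
  module SK = Simulation E (4 + ((tM + tM) + (tK + tK))) {K.Aux} inj₂ isInj₂ (λ _ → refl)

  open Marker E (4 + ((tM + tM) + (tK + tK))) public

  onHead onSecond : ∀ {n} → Act → Bank Act (2 + n)
  onHead a   = replicateᵛ _ keep , a ∷ replicateᵛ _ keep
  onSecond a = replicateᵛ _ keep , keep ∷ a ∷ replicateᵛ _ keep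

  onHead-apply : ∀ {n} a l r (rs : Vec (List Sym) (1 + n)) →
    applyBank (just (onHead a)) (l , r ∷ rs) ≡ (l , applyAct a r ∷ rs)
  onHead-apply a l r rs = cong₂ (λ l rs → l , applyAct a r ∷ rs) (keep-all l) (keep-all rs)

  onSecond-apply : ∀ {n} a l r r′ (rs : Vec (List Sym) n) →
    applyBank (just (onSecond a)) (l , r ∷ r′ ∷ rs) ≡ (l , r ∷ applyAct a r′ ∷ rs)
  onSecond-apply a l r r′ rs =
    cong₂ (λ l rs → l , r ∷ applyAct a r′ ∷ rs) (keep-all l) (keep-all rs)

  bottoms : ∀ {n} → Bank Act n
  bottoms = replicateᵛ _ (push bottom) , replicateᵛ _ (push bottom)

  refills : ∀ {n} → Bank Sym n → Bank Act n
  refills (_ , r) = replicateᵛ _ keep , mapᵛ refillAct r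

  second : ∀ {n} → Bank Sym (2 + n) → Sym
  second (_ , r) = head (tail r)

  openM : Prog ⊤
  openM = acts λ _ → tt , record keepAll { acts₁ = just bottoms }

  -- The blank on the query tape ends the word about to be written above it, so that earlier queries
  -- and abandoned padding rounds may stay below.
  openK : Prog ⊤
  openK = acts λ _ → tt , record keepAll { actQ = push blank ; acts₂ = just bottoms }

  refillM refillK : ∀ {A} → A → Prog A
  refillM a = acts λ v → a , record keepAll { acts₁ = just (refills (bank₁ v)) }
  refillK a = acts λ v → a , record keepAll { acts₂ = just (refills (bank₂ v)) }

  moveM : (Vec (Symbol M.Aux) tM → M.State × Vec (Symbol M.Aux × Direction) tM) → Prog M.State
  moveM δ = acts λ v → let q , a = SM.simulateMove δ (bank₁ v) in q , record keepAll { acts₁ = just a }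

  moveK : (Vec (Symbol K.Aux) tK → K.State × Vec (Symbol K.Aux × Direction) tK) → Prog K.State
  moveK δ = acts λ v → let q , a = SK.simulateMove δ (bank₂ v) in q , record keepAll { acts₂ = just a }

  X→Y Y→XM M→VY V→M K→Y : Prog ⊤
  X→Y  = drain regX λ b → record keepAll { actX = pop ; actY = push (bit b) }
  Y→XM = drain regY λ b → record keepAll
    { actY = pop ; actX = push (bit b) ; acts₁ = just (onHead (push (bit b))) }
  M→VY = drain (λ v → second (bank₁ v)) λ b → record keepAll
    { actV = push (bit b) ; actY = push (bit b) ; acts₁ = just (onSecond pop) }
  V→M  = drain regV λ b → record keepAll
    { actV = pop ; acts₁ = just (onSecond (push (bit b))) }
  K→Y  = drain (λ v → second (bank₂ v)) λ b → record keepAll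
    { actY = push (bit b) ; acts₂ = just (onSecond pop) }

  load : Prog ⊤
  load = bind X→Y λ _ → bind openM λ _ → bind Y→XM λ _ → refillM tt

  copyQuery : Prog ⊤
  copyQuery = bind M→VY λ _ → V→M

  fillStep : Maybe Bool → Maybe Bool → (⊤ ⊎ Bool) × Acts
  fillStep (just b) (just c) = inj₁ tt , record keepAll
    { actQ = push (bit b) ; actY = pop ; actV = push (bit c) ; actT = pop
    ; acts₂ = just (onHead (push (bit b))) }
  fillStep (just b) nothing  = inj₁ tt , record keepAll
    { actQ = push (bit b) ; actY = pop ; acts₂ = just (onHead (push (bit b))) }
  -- T is consumed alongside Y, so letters of T are left exactly when the word is strictly shorter.
  fillStep nothing  (just _) = inj₂ true , keepAll
  fillStep nothing  nothing  = inj₂ false , keepAll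

  -- Copies the reversed word in Y to the query tape and to the input of K,
  -- and tells whether it is shorter than T.
  fill : Prog Bool
  fill = loop (λ _ → acts λ v → fillStep (letter (regY v)) (letter (regT v))) tt

  instance
    M-State-finite : IsFinite M.State
    M-State-finite = M.finiteState

    K-State-finite : IsFinite K.State
    K-State-finite = K.finiteState

  stepK : Instruction K.State K.Aux tK → Prog (K.State ⊎ ⊤)
  stepK (halt _)    = ret (inj₂ tt)
  -- A default value: the simulated computations of `K` have an empty list of queries.
  stepK (query _ _) = ret (inj₂ tt)
  stepK (move δ)    = bind (moveK δ) λ q → refillK (inj₁ q)

  runK : K.State → Prog ⊤
  runK = loop λ q → stepK (K.instruction q)

  padMore : Bool → Prog (⊤ ⊎ ⊤)
  padMore false = ret (inj₂ tt)
  padMore true  = bind (refillK tt) λ _ → bind (runK K.start) λ _ → bind K→Y λ _ → ret (inj₁ tt)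

  padRound : Prog (⊤ ⊎ ⊤)
  padRound = bind openK λ _ → bind fill λ shorter → bind V→T λ _ → padMore shorter

  pad : Prog ⊤
  pad = loop (λ _ → padRound) tt

  refill-bank : ∀ {n} (l r : Vec (List Sym) n) →
    applyBank (just (refills (mapᵛ top l , mapᵛ top r))) (l , r) ≡
    (l , zipWith applyAct (mapᵛ refillAct (mapᵛ top r)) r)
  refill-bank l r = cong (_, _) (keep-all l)

  loadCost : ℕ → ℕ
  loadCost n = 2 + n * 3 + suc (2 + suc (2 + n * 3 + 3))

  load-exec : ∀ x {as} → ∃[ l ] ∃[ r ] (SM.Bankwise SM.Exact (tapes (initial M x)) l r ×
    Exec load (initialState x) as (loadCost (length x)) [] tt
         (words [] (l , r) (replicateᵛ tK [] , replicateᵛ tK []) x [] [] [] []) as)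
  load-exec x {as} = l , _ , SM.refills-exact loose ,
    exec-cost (cong (λ m → 2 + length x * 3 + suc (2 + suc (2 + m * 3 + 3))) (length-reverse x))
      (exec-bind (drain-exec (λ u w → words [] (replicateᵛ tM [] , replicateᵛ tM []) b₂ w u [] [] [])
                    (λ _ _ _ → refl) (λ _ _ _ → refl) (λ _ → refl) [] x)
      (exec-bind exec-acts
      (exec-bind (exec-to (cong (λ u → loading u []) (ʳ++-involutive x))
                    (drain-exec loading (λ _ _ _ → refl)
                       (λ u b w → cong (λ b₁ → words [] b₁ b₂ (b ∷ u) w [] [] [])
                                       (onHead-apply (push (bit b)) l (map bit u ++ bottom ∷ []) rs))
                       (λ _ → refl) [] (x ʳ++ [])))
      (exec-to (cong (λ b₁ → words [] b₁ b₂ x [] [] [] [])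
                     (refill-bank l ((map bit x ++ bottom ∷ []) ∷ rs)))
               exec-acts))))
    where
    b₂ : Bank (List Sym) tK
    b₂ = replicateᵛ tK [] , replicateᵛ tK []
    l : Vec (List Sym) tM
    l = zipWith applyAct (replicateᵛ tM (push bottom)) (replicateᵛ tM [])
    rs : Vec (List Sym) (1 + M.work)
    rs = zipWith applyAct (replicateᵛ _ (push bottom)) (replicateᵛ _ [])
    loading : Word → Word → State
    loading u w = words [] (l , (map bit u ++ bottom ∷ []) ∷ rs) b₂ u w [] [] []
    loose : SM.Bankwise SM.Loose (tapes (initial M x)) l ((map bit x ++ bottom ∷ []) ∷ rs)
    loose = SM.word-loose x [] [] SM.∷ SM.empties-loose _ _

-- Padding a query beyond the target length

module Padding (M K : Machine) {σ : Word → Word} {k : ℕ} {pσ : Polynomial}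
  (computes : ∀ x → ComputesWithin K x (σ x) (eval pσ (length x)))
  (grows : ∀ x → length x < length (σ x))
  (tight : ∀ x → length (σ x) ≤ length x + k) where

  open Simulators M K public

  private
    module M = Machine M
    module K = Machine K

  data _↝_ : Word → Word → Set where
    stop : ∀ {w} → w ↝ w
    more : ∀ {w w′} → σ w ↝ w′ → w ↝ w′

  copyCost : ℕ → ℕ
  copyCost m = 2 + m * 3 + suc (2 + m * 3)

  lastRoundCost padRoundCost : ℕ → ℕ
  lastRoundCost m   = 2 + suc (2 + m * 3 + suc (2 + m * 3 + 1))
  padRoundCost m = 2 + suc (2 + m * 3 + suc (2 + m * 3 + suc
    (2 + suc (eval pσ m * 6 + suc (2 + m * 3 + 1)))))

  -- Here `m` bounds the lengths of all words involved and `d` the number of applications of `σ`;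
  -- the last round only finds the word long enough.
  padCost : ℕ → ℕ → ℕ
  padCost m d = d * suc (padRoundCost m) + lastRoundCost m

  module _ {x c : Word} {as : List Bool} where

    copyQuery-exec : ∀ {q b₂ t} {ts : Vec (Tape M.Aux) tM} {l r} → SM.Bankwise SM.Exact ts l r →
      let w = tapeWord (head (tail ts)) in
      Exec copyQuery (words q (l , r) b₂ x [] [] c t) as (copyCost (length w)) [] tt
           (words q (l , r) b₂ x (w ʳ++ []) [] c t) as
    copyQuery-exec {q} {b₂} {t} {ts = _ ∷ t₁ ∷ _} {l} {r₀ ∷ _ ∷ rs} (_ SM.∷ ((_ , R₁) SM.∷ _))
      with r′ , refl , no-letter ← SM.word-letters {scanned t₁ ∷ rights t₁} R₁ =
      exec-cost (cong (λ m → 2 + length w * 3 + suc (2 + m * 3)) (length-reverse w))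
        (exec-bind
          (drain-exec (λ u w → words q (bank w) b₂ x u u c t) (λ _ _ _ → refl)
             (λ u b w → cong (λ b₁ → words q b₁ b₂ x (b ∷ u) (b ∷ u) c t)
                             (onSecond-apply pop l r₀ (map bit (b ∷ w) ++ r′) rs))
             (λ _ → no-letter) [] w)
          (exec-to (cong (λ w → words q (bank w) b₂ x y [] c t) (ʳ++-involutive w))
            (drain-exec (λ u w → words q (bank u) b₂ x y w c t) (λ _ _ _ → refl)
               (λ u b w → cong (λ b₁ → words q b₁ b₂ x y w c t)
                               (onSecond-apply (push (bit b)) l r₀ (map bit u ++ r′) rs))
               (λ _ → refl) [] y)))
      where
      w : Word
      w = tapeWord t₁
      y : Word
      y = w ʳ++ []
      bank : Word → Bank (List Sym) tM
      bank w = l , r₀ ∷ (map bit w ++ r′) ∷ rs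

    Verdict : Bool → Word → Word → Set
    Verdict true  y t = length y < length t
    Verdict false y t = length t ≤ length y

    module _ {q : List Sym} {b₁ : Bank (List Sym) tM} {l : Vec (List Sym) tK} {j : List Sym}
      {rs : Vec (List Sym) (1 + K.work)} where

      filling : Word → Word → Word → Word → State
      filling y t v u =
        words (map bit u ++ blank ∷ q) b₁ (l , (map bit u ++ bottom ∷ j) ∷ rs) x y v c t

      -- The comparison destroys T, but `v′ ʳ++ t′ ≡ v ʳ++ t` says that its letters survive in V and
      -- T together, from which `V→T` restores it.
      fill-exec : ∀ y t v u → ∃[ t′ ] ∃[ v′ ] ∃[ b ] (v′ ʳ++ t′ ≡ v ʳ++ t × Verdict b y t ×
        Exec fill (filling y t v u) as (2 + length y * 3) [] b (filling [] t′ v′ (y ʳ++ u)) as)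
      fill-exec []      []      v u = _ , _ , _ , refl , z≤n , exec-leave exec-acts
      fill-exec []      (_ ∷ t) v u = _ , _ , _ , refl , s≤s z≤n , exec-leave exec-acts
      fill-exec (b ∷ y) []      v u =
        let t′ , v′ , a , eq , verdict , r = fill-exec y [] v (b ∷ u)
        in t′ , v′ , a , eq , weaken a verdict ,
           exec-again (exec-to (cong (λ b₂ → words (map bit (b ∷ u) ++ blank ∷ q) b₁ b₂ x y v c [])
                                     (onHead-apply (push (bit b)) l (map bit u ++ bottom ∷ j) rs))
                               exec-acts) r
        where
        weaken : ∀ a → Verdict a y [] → Verdict a (b ∷ y) []
        weaken false _ = z≤n
      fill-exec (b ∷ y) (z ∷ t) v u =
        let t′ , v′ , a , eq , verdict , r = fill-exec y t (z ∷ v) (b ∷ u)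
        in t′ , v′ , a , eq , shift-verdict a verdict ,
           exec-again (exec-to (cong (λ b₂ → words (map bit (b ∷ u) ++ blank ∷ q) b₁ b₂ x y (z ∷ v) c t)
                                     (onHead-apply (push (bit b)) l (map bit u ++ bottom ∷ j) rs))
                               exec-acts) r
        where
        shift-verdict : ∀ a → Verdict a y t → Verdict a (b ∷ y) (z ∷ t)
        shift-verdict true  = s≤s
        shift-verdict false = s≤s

    module _ {q : List Sym} {b₁ : Bank (List Sym) tM} {y v t : Word} where

      moveK-exec : ∀ δ {ts : Vec (Tape K.Aux) tK} {l r} → SK.Bankwise SK.Exact ts l r →
        ∃[ l′ ] ∃[ r′ ] (SK.Bankwise SK.Exact (zipWith writeShift (proj₂ (δ (mapᵛ scanned ts))) ts) l′ r′ ×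
          Exec (stepK (move δ)) (words q b₁ (l , r) x y v c t) as 5 []
               (inj₁ (proj₁ (δ (mapᵛ scanned ts)))) (words q b₁ (l′ , r′) x y v c t) as)
      moveK-exec δ {ts} {l} {r} e =
        subst (λ u → ∃[ l′ ] ∃[ r′ ] (SK.Bankwise SK.Exact (zipWith writeShift (proj₂ (δ u)) ts) l′ r′ ×
                 Exec (stepK (move δ)) (words q b₁ (l , r) x y v c t) as 5 []
                      (inj₁ (proj₁ (δ u))) (words q b₁ (l′ , r′) x y v c t) as))
              (SK.decode-tops e)
              (_ , _ , SK.refills-exact (SK.moves-loose e _) ,
               exec-bind exec-acts
                 (exec-to (cong (λ b₂ → words q b₁ b₂ x y v c t) (refill-bank _ _)) exec-acts))

      -- The factor 6 is five steps for a move of `K` and one for the jump back to the head of the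
      -- loop.
      runK-exec : ∀ {n i d} → Computation K ∅ i n [] d → Halted K d →
        ∀ {l r} → SK.Bankwise SK.Exact (tapes i) l r →
        ∃[ l′ ] ∃[ r′ ] (SK.Bankwise SK.Exact (tapes d) l′ r′ ×
          Exec (runK (state i)) (words q b₁ (l , r) x y v c t) as (n * 6) [] tt
               (words q b₁ (l′ , r′) x y v c t) as)
      runK-exec done (_ , halts) {l} {r} e = l , r , e ,
        exec-leave (exec-prog (cong stepK (sym halts)) exec-ret)
      runK-exec (step {δ = δ} eq comp) halts e =
        let _ , _ , e′ , r = moveK-exec δ e
            l″ , r″ , e″ , r′ = runK-exec comp halts e′
        in l″ , r″ , e″ ,
           exec-again (exec-prog (cong stepK (sym eq)) r) r′

    module _ {q : List Sym} {b₁ : Bank (List Sym) tM} {t : Word} where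

      K→Y-exec : ∀ {ts : Vec (Tape K.Aux) tK} {l r w} → SK.Bankwise SK.Exact ts l r →
        tapeWord (head (tail ts)) ≡ w →
        ∃[ r′ ] Exec K→Y (words q b₁ (l , r) x [] [] c t) as (2 + length w * 3) [] tt
                         (words q b₁ (l , r′) x (w ʳ++ []) [] c t) as
      K→Y-exec {ts = _ ∷ t₁ ∷ _} {l} {r₀ ∷ _ ∷ rs} (_ SK.∷ ((_ , R₁) SK.∷ _)) refl
        with r′ , refl , no-letter ← SK.word-letters {scanned t₁ ∷ rights t₁} R₁ =
        _ , drain-exec (λ u w → words q b₁ (l , r₀ ∷ (map bit w ++ r′) ∷ rs) x u [] c t)
              (λ _ _ _ → refl)
              (λ u b w → cong (λ b₂ → words q b₁ b₂ x (b ∷ u) [] c t)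
                              (onSecond-apply pop l r₀ (map bit (b ∷ w) ++ r′) rs))
              (λ _ → no-letter) [] (tapeWord t₁)

      applyK-exec : ∀ w {l j} {rs : Vec (List Sym) (1 + K.work)} →
        SK.Bankwise SK.Loose (tapes (initial K w)) l ((map bit w ++ bottom ∷ j) ∷ rs) →
        ∃[ l′ ] ∃[ r′ ] Exec (padMore true)
          (words q b₁ (l , (map bit w ++ bottom ∷ j) ∷ rs) x [] [] c t) as
          (2 + suc (eval pσ (length w) * 6 + suc (2 + length (σ w) * 3 + 1))) [] (inj₁ tt)
          (words q b₁ (l′ , r′) x (σ w ʳ++ []) [] c t) as
      applyK-exec w {l} {j} {rs} loose
        with n , d , n≤ , comp , halts , output ← computes w
        with l′ , r′ , e , r ← runK-exec comp halts (SK.refills-exact loose)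
        with r″ , r′ ← K→Y-exec e output =
        l′ , r″ ,
        exec-slack (+-monoʳ-≤ 3 (+-monoˡ-≤ (suc (2 + length (σ w) * 3 + 1)) (*-monoˡ-≤ 6 n≤)))
          (exec-bind (exec-to (cong (λ b₂ → words q b₁ b₂ x [] [] c t) (refill-bank l ((map bit w ++ bottom ∷ j) ∷ rs))) exec-acts)
          (exec-bind r (exec-bind r′ exec-ret)))

    -- The two verdicts continue differently, so the execution of `padMore b` is taken as an
    -- argument once the verdict is known.
    padRound-exec : ∀ {m w t q b₁ l₀ r₀} (l r : Vec (List Sym) (1 + K.work)) →
      length w ≤ m → length t ≤ m →
      ∃[ b ] (Verdict b w t × (∀ {n a s} →
        Exec (padMore b) (filling {q} {b₁} {zipWith applyAct (replicateᵛ _ (push bottom)) (l₀ ∷ l)} {r₀}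
                            {zipWith applyAct (replicateᵛ _ (push bottom)) r} [] t [] w) as n [] a s as →
        Exec padRound (words q b₁ (l₀ ∷ l , r₀ ∷ r) x (w ʳ++ []) [] c t) as
             (2 + suc (2 + m * 3 + suc (2 + m * 3 + suc n))) [] a s as))
    padRound-exec {m} {w} {t} {q} {b₁} {l₀} {r₀} l r w≤m t≤m
      with t′ , v′ , b , eq , verdict , filled ←
             fill-exec {q} {b₁} {zipWith applyAct (replicateᵛ _ (push bottom)) (l₀ ∷ l)} {r₀}
                       {zipWith applyAct (replicateᵛ _ (push bottom)) r} (w ʳ++ []) t [] [] =
      b , measured b verdict , λ continued →
        exec-bind exec-acts (exec-bind filled′ (exec-bind restored continued))
      where
      ls : Vec (List Sym) tK
      ls = zipWith applyAct (replicateᵛ _ (push bottom)) (l₀ ∷ l)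
      rs : Vec (List Sym) (1 + K.work)
      rs = zipWith applyAct (replicateᵛ _ (push bottom)) r
      measured : ∀ b → Verdict b (w ʳ++ []) t → Verdict b w t
      measured true  = subst (_< length t) (length-reverse w)
      measured false = subst (length t ≤_) (length-reverse w)
      v≤m : length v′ ≤ m
      v≤m = begin
        length v′               ≤⟨ m≤m+n _ _ ⟩
        length v′ + length t′   ≡⟨ length-ʳ++ v′ t′ ⟨
        length (v′ ʳ++ t′)      ≡⟨ cong length eq ⟩
        length t                ≤⟨ t≤m ⟩
        m                       ∎
        where open ≤-Reasoning
      filled′ : Exec fill (filling {q} {b₁} {ls} {r₀} {rs} (w ʳ++ []) t [] []) as (2 + m * 3) [] b
                     (filling {q} {b₁} {ls} {r₀} {rs} [] t′ v′ w) as
      filled′ = exec-slack (+-monoʳ-≤ 2 (*-monoˡ-≤ 3 (≤-trans (≤-reflexive (length-reverse w)) w≤m)))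
        (exec-to (cong (filling {q} {b₁} {ls} {r₀} {rs} [] t′ v′) (ʳ++-involutive w)) filled)
      restored : Exec V→T (filling {q} {b₁} {ls} {r₀} {rs} [] t′ v′ w) as (2 + m * 3) [] tt
                      (filling {q} {b₁} {ls} {r₀} {rs} [] t [] w) as
      restored = exec-slack (+-monoʳ-≤ 2 (*-monoˡ-≤ 3 v≤m))
        (exec-to (cong (λ t → filling {q} {b₁} {ls} {r₀} {rs} [] t [] w) eq)
          (drain-exec (λ u v → filling {q} {b₁} {ls} {r₀} {rs} [] u v w)
             (λ _ _ _ → refl) (λ _ _ _ → refl) (λ _ → refl) t′ v′))

    -- Induction on `d`, a bound on what `w` lacks to the target: every application of `σ` gains at
    -- least one letter and so uses up one unit.
    pad-exec : ∀ d {m w t q b₁} (l r : Vec (List Sym) tK) →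
      length t ≤ length w + d → length w < length t + k → length t + k ≤ m →
      ∃[ w′ ] ∃[ q′ ] ∃[ b₂′ ] (w ↝ w′ × length t ≤ length w′ × length w′ < length t + k ×
        Exec pad (words q b₁ (l , r) x (w ʳ++ []) [] c t) as (padCost m d) [] tt
             (words (map bit w′ ++ blank ∷ q′) b₁ b₂′ x [] [] c t) as)
    pad-exec d {m} {w} {t} {q} {b₁} (l₀ ∷ l) (r₀ ∷ r) t≤ w< ≤m
      with padRound-exec {m} {w} {t} {q} {b₁} {l₀} {r₀} l r
             (≤-trans (<⇒≤ w<) ≤m) (≤-trans (m≤m+n _ _) ≤m)
    ... | false , t≤w , body =
      w , q , _ , stop , t≤w , w< ,
      exec-slack (m≤n+m (lastRoundCost m) (d * suc (padRoundCost m))) (exec-leave (body exec-ret))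
    pad-exec zero {w = w} {t} (_ ∷ _) (_ ∷ _) t≤ _ _ | true , w<t , _ =
      -- With nothing lacking, `w` has reached the target, against the verdict.
      ⊥-elim (<⇒≱ w<t (subst (length t ≤_) (+-identityʳ (length w)) t≤))
    pad-exec (suc d) {m} {w} {t} {q} {b₁} (l₀ ∷ l) (r₀ ∷ r) t≤ w< ≤m | true , w<t , body
      -- `σ` is applied only below the target and adds at most `k` letters, so its result cannot
      -- overshoot the window.
      with σw< ← ≤-<-trans (tight w) (+-monoˡ-< k w<t)
      with l′ , r′ , applied ← applyK-exec {map bit w ++ blank ∷ q} {b₁} {t} w
                                 (SK.word-loose w l₀ r₀ SK.∷ SK.empties-loose l r)
      with w′ , q′ , b₂′ , σw↝ , t≤w′ , w′< , padded ←
             pad-exec d {m} {σ w} {t} {map bit w ++ blank ∷ q} {b₁} l′ r′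
               (≤-trans t≤ (≤-trans (≤-reflexive (+-suc (length w) d)) (+-monoˡ-≤ d (grows w)))) σw< ≤m =
      w′ , q′ , b₂′ , more σw↝ , t≤w′ , w′< ,
      exec-cost (lemma (padRoundCost m) (d * suc (padRoundCost m)) (lastRoundCost m))
        (exec-again (body (exec-slack cost applied)) padded)
      where
      lemma : ∀ a b c → a + suc (b + c) ≡ suc a + b + c
      lemma = solve-∀
      cost : 2 + suc (eval pσ (length w) * 6 + suc (2 + length (σ w) * 3 + 1)) ≤
             2 + suc (eval pσ m * 6 + suc (2 + m * 3 + 1))
      cost = +-monoʳ-≤ 3 (+-mono-≤ (*-monoˡ-≤ 6 (eval-mono pσ (≤-trans (<⇒≤ w<) ≤m)))
        (s≤s (+-monoˡ-≤ 1 (+-monoʳ-≤ 2 (*-monoˡ-≤ 3 (≤-trans (<⇒≤ (≤-<-trans (tight w) (+-monoˡ-< k w<t))) ≤m))))))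

-- Simulating an oracle machine with padded queries

module Reduction (M K : Machine) {σ : Word → Word} {k : ℕ} {pσ : Polynomial}
  (computes : ∀ x → ComputesWithin K x (σ x) (eval pσ (length x)))
  (grows : ∀ x → length x < length (σ x))
  (tight : ∀ x → length (σ x) ≤ length x + k) where

  open Padding M K {pσ = pσ} computes grows tight public

  private
    module M = Machine M

  -- How the target length changes with every simulated step, and what this
  -- means for the lengths of the remaining queries: a query made at target
  -- length n is padded to a length between n and n + k.
  record Strategy : Set₁ where
    field
      tick       : Prog ⊤
      retarget   : Word → Word
      tick-exec  : ∀ {q b₁ b₂ x y v c t as} → Exec tick (words q b₁ b₂ x y v c t) as (k * 3) [] tt
                                                   (words q b₁ b₂ x y v c (retarget t)) as
      lower      : ∀ t → length t ≤ length (retarget t) + k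
      upper      : ∀ t → length (retarget t) ≤ length t + k
      Fits       : Word → List ℕ → Set
      fits-[]    : ∀ t → Fits t []
      fits-tick  : ∀ t {ls} → Fits (retarget t) ls → Fits t ls
      -- The condition `k ≤ length t` keeps a downward move from being truncated at zero, where the
      -- windows would overlap.
      fits-query : ∀ t {n ls} → k ≤ length t → length (retarget t) ≤ n → n < length (retarget t) + k →
                   Fits (retarget t) ls → Fits t (n ∷ ls)

  -- The upward and the downward strategy

  repeat : Act → ℕ → Prog ⊤
  repeat a zero    = ret tt
  repeat a (suc n) = bind (acts λ _ → tt , record keepAll { actT = a }) λ _ → repeat a n

  raise drop : ℕ → Word → Word
  raise zero    t = t
  raise (suc n) t = raise n (true ∷ t)
  drop zero    t = t
  drop (suc n) t = drop n (rest t)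

  length-raise : ∀ n t → length (raise n t) ≡ length t + n
  length-raise zero    t = sym (+-identityʳ _)
  length-raise (suc n) t = trans (length-raise n (true ∷ t)) (sym (+-suc (length t) n))

  length-drop : ∀ n t → length (drop n t) ≡ length t ∸ n
  length-drop zero    t       = refl
  length-drop (suc n) []      = trans (length-drop n []) (0∸n≡0 n)
  length-drop (suc n) (_ ∷ t) = length-drop n t

  raise-exec : ∀ n {q b₁ b₂ x y v c t as} → Exec (repeat (push one) n) (words q b₁ b₂ x y v c t) as
    (n * 3) [] tt (words q b₁ b₂ x y v c (raise n t)) as
  raise-exec zero    = exec-ret
  raise-exec (suc n) = exec-bind exec-acts (raise-exec n)

  drop-exec : ∀ n {q b₁ b₂ x y v c t as} → Exec (repeat pop n) (words q b₁ b₂ x y v c t) as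
    (n * 3) [] tt (words q b₁ b₂ x y v c (drop n t)) as
  drop-exec zero                = exec-ret
  drop-exec (suc n) {t = []}    = exec-bind exec-acts (drop-exec n {t = []})
  drop-exec (suc n) {t = _ ∷ t} = exec-bind exec-acts (drop-exec n {t = t})

  -- In `Fits`, `b` stands for the preceding query, or for the input at the start. It lies below the
  -- end `length t + k` of the current window, which is where the next window begins.
  increasing : Strategy
  increasing = record
    { tick       = repeat (push one) k
    ; retarget   = raise k
    ; tick-exec  = raise-exec k
    ; lower      = λ t → ≤-trans (m≤m+n (length t) k)
                           (≤-trans (≤-reflexive (sym (length-raise k t))) (m≤m+n _ k))
    ; upper      = λ t → ≤-reflexive (length-raise k t)
    ; Fits       = λ t ls → ∀ b → b < length t + k → Linked _<_ (b ∷ ls)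
    ; fits-[]    = λ _ _ _ → [-]
    ; fits-tick  = λ t fits b b< → fits b (≤-trans b<
                     (≤-trans (≤-reflexive (sym (length-raise k t))) (m≤m+n _ k)))
    ; fits-query = λ t _ ≤n n< fits b b< →
                     ≤-trans b< (≤-trans (≤-reflexive (sym (length-raise k t))) ≤n) ∷ fits _ n<
    }

  -- The preceding length `b` is at least `length t`, and the next window, starting `k` lower, ends
  -- just below `length t`.
  decreasing : Strategy
  decreasing = record
    { tick       = repeat pop k
    ; retarget   = drop k
    ; tick-exec  = drop-exec k
    ; lower      = λ t → ≤-trans (m≤n+m∸n (length t) k) (≤-reflexive (trans (+-comm k _)
                           (cong (_+ k) (sym (length-drop k t)))))
    ; upper      = λ t → ≤-trans (≤-reflexive (length-drop k t))
                           (≤-trans (m∸n≤m (length t) k) (m≤m+n _ k))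
    ; Fits       = λ t ls → ∀ b → length t ≤ b → Linked _>_ (b ∷ ls)
    ; fits-[]    = λ _ _ _ → [-]
    ; fits-tick  = λ t fits b t≤b → fits b
                     (≤-trans (≤-trans (≤-reflexive (length-drop k t)) (m∸n≤m (length t) k)) t≤b)
    ; fits-query = λ t k≤t ≤n n< fits b t≤b →
                     ≤-trans n< (≤-trans (≤-reflexive (trans (cong (_+ k) (length-drop k t)) (m∸n+n≡m k≤t))) t≤b)
                     ∷ fits _ ≤n
    }

  data Pads : Log → Log → Set where
    []  : Pads [] []
    _∷_ : ∀ {w w′ b log log′} → w ↝ w′ → Pads log log′ → Pads ((w , b) ∷ log) ((w′ , b) ∷ log′)

  lengths : Log → List ℕ
  lengths = map length ∘ map proj₁

  leadingBits-word : ∀ w {s : List Sym} → leadingBits (map bit w ++ blank ∷ s) ≡ w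
  leadingBits-word []      = refl
  leadingBits-word (b ∷ w) = cong (b ∷_) (leadingBits-word w)

  leadingBits-≤ : ∀ {A} (s : List (Symbol A)) → length (leadingBits s) ≤ length s
  leadingBits-≤ []          = z≤n
  leadingBits-≤ (blank ∷ s) = z≤n
  leadingBits-≤ (bit b ∷ s) = s≤s (leadingBits-≤ s)
  leadingBits-≤ (aux a ∷ s) = z≤n

  -- Counts all stored cells from the head to the right on the query tape, not just the query word:
  -- that word can grow by many letters at once when a blank in front of other letters is
  -- overwritten, whereas `space` grows by at most one per step.
  space : ∀ {A n} → Vec (Tape A) (2 + n) → ℕ
  space ts = suc (length (rights (head (tail ts))))

  space-move : ∀ {A n} (xs : Vec (Symbol A × Direction) (2 + n)) ts →
    space (zipWith writeShift xs ts) ≤ suc (space ts)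
  space-move (_ ∷ (a , stay)  ∷ _) (_ ∷ tape _ _ _ ∷ _)        = n≤1+n _
  space-move (_ ∷ (a , left)  ∷ _) (_ ∷ tape [] _ _ ∷ _)       = ≤-refl
  space-move (_ ∷ (a , left)  ∷ _) (_ ∷ tape (_ ∷ _) _ _ ∷ _)  = ≤-refl
  space-move (_ ∷ (a , right) ∷ _) (_ ∷ tape _ _ [] ∷ _)       = n≤1+n _
  space-move (_ ∷ (a , right) ∷ _) (_ ∷ tape _ _ (_ ∷ r) ∷ _)  =
    s≤s (≤-trans (n≤1+n (length r)) (n≤1+n _))

  exec-ask-word : ∀ {s as w} → leadingBits (regQ s) ≡ w →
    Exec ask s as 1 ((w , answer as) ∷ []) (answer as) s (rest as)
  exec-ask-word refl = exec-ask

  popC : Maybe Bool → Bool × Acts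
  popC (just _) = true , record keepAll { actC = pop }
  popC nothing  = false , keepAll

  stepM : Instruction M.State M.Aux tM → Prog (M.State ⊎ Bool)
  stepM (halt b)    = ret (inj₂ b)
  stepM (query y n) = bind copyQuery λ _ → bind pad λ _ → bind ask λ b →
                      ret (inj₁ (if b then y else n))
  stepM (move δ)    = bind (moveM δ) λ q → refillM (inj₁ q)

  queryCost : ℕ → ℕ
  queryCost m = copyCost m + suc (padCost m m + 3)

  moveM-exec : ∀ δ {q b₂ x y v c t as} {ts : Vec (Tape M.Aux) tM} {l r} → SM.Bankwise SM.Exact ts l r →
    ∃[ l′ ] ∃[ r′ ] (SM.Bankwise SM.Exact (zipWith writeShift (proj₂ (δ (mapᵛ scanned ts))) ts) l′ r′ ×
      Exec (stepM (move δ)) (words q (l , r) b₂ x y v c t) as 5 []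
           (inj₁ (proj₁ (δ (mapᵛ scanned ts)))) (words q (l′ , r′) b₂ x y v c t) as)
  moveM-exec δ {q} {b₂} {x} {y} {v} {c} {t} {as} {ts} {l} {r} e =
    subst (λ u → ∃[ l′ ] ∃[ r′ ] (SM.Bankwise SM.Exact (zipWith writeShift (proj₂ (δ u)) ts) l′ r′ ×
             Exec (stepM (move δ)) (words q (l , r) b₂ x y v c t) as 5 []
                  (inj₁ (proj₁ (δ u))) (words q (l′ , r′) b₂ x y v c t) as))
          (SM.decode-tops e)
          (_ , _ , SM.refills-exact (SM.moves-loose e _) ,
           exec-bind exec-acts
             (exec-to (cong (λ b₁ → words q b₁ b₂ x y v c t) (refill-bank _ _)) exec-acts))

  queryM-exec : ∀ {y n m q b₂ x c t as} {ts : Vec (Tape M.Aux) tM} {l r} →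
    SM.Bankwise SM.Exact ts l r → space ts < length t → length t + k ≤ m →
    ∃[ w′ ] ∃[ q′ ] ∃[ b₂′ ] (tapeWord (head (tail ts)) ↝ w′ ×
      length t ≤ length w′ × length w′ < length t + k ×
      Exec (stepM (query y n)) (words q (l , r) b₂ x [] [] c t) as (queryCost m)
           ((w′ , answer as) ∷ []) (inj₁ (if answer as then y else n))
           (words q′ (l , r) b₂′ x [] [] c t) (rest as))
  queryM-exec {y} {n} {m} {q} {l₂ , r₂} {x} {c} {t} {as} {ts} {l} {r} e <t ≤m =
    let w≤          = leadingBits-≤ (scanned (head (tail ts)) ∷ rights (head (tail ts)))
        w<          = ≤-trans (≤-<-trans w≤ <t) (m≤m+n _ k)
        t≤m         = ≤-trans (m≤m+n (length t) k) ≤m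
        w≤m         = ≤-trans (<⇒≤ w<) ≤m
        -- The whole bound `m` serves as the number of applications allowed: the target itself is no
        -- longer than `m`.
        w′ , _ , b₂′ , w↝w′ , t≤ , <t+k , padded =
          pad-exec {x} {c} m {m} {tapeWord (head (tail ts))} {t} {q} {l , r} l₂ r₂
            (≤-trans t≤m (m≤n+m m _)) w< ≤m
    in w′ , _ , b₂′ , w↝w′ , t≤ , <t+k ,
       exec-bind (exec-slack (copy-mono w≤m) (copyQuery-exec e))
         (exec-bind padded (exec-bind (exec-ask-word (leadingBits-word w′)) exec-ret))
    where
    copy-mono : ∀ {n m} → n ≤ m → copyCost n ≤ copyCost m
    copy-mono n≤m = +-mono-≤ (+-monoʳ-≤ 2 (*-monoˡ-≤ 3 n≤m)) (+-monoʳ-≤ 3 (*-monoˡ-≤ 3 n≤m))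

-- The simulation loop

module Simulate (M K : Machine) {σ : Word → Word} {k : ℕ} {pσ : Polynomial}
  (computes : ∀ x → ComputesWithin K x (σ x) (eval pσ (length x)))
  (grows : ∀ x → length x < length (σ x))
  (tight : ∀ x → length (σ x) ≤ length x + k)
  (strategy : Reduction.Strategy M K {pσ = pσ} computes grows tight) where

  open Reduction M K {pσ = pσ} computes grows tight public
  open Strategy strategy public

  private
    module M = Machine M

  timed : M.State → Bool → Prog (M.State ⊎ Bool)
  timed q false = ret (inj₂ false)
  timed q true  = bind tick λ _ → stepM (M.instruction q)

  main : M.State → Prog Bool
  main = loop λ q → bind (acts λ v → popC (letter (regC v))) (timed q)

  -- The summand `5 + queryCost m` covers a simulated move, which costs 5, as well as a simulated
  -- query.
  stepCost : ℕ → ℕ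
  stepCost m = 3 + (k * 3 + suc (5 + queryCost m))

  mainCost : ℕ → ℕ → ℕ
  mainCost m c = c * suc (stepCost m) + 3

  record Simulated (i : Configuration M) (as : List Bool) (time : ℕ) (t : Word)
                   (p : Prog Bool) (s : State) (cost : ℕ) : Set₁ where
    field
      {steps}          : ℕ
      {logM log}       : Log
      {as′}            : List Bool
      {final}          : Configuration M
      {verdict}        : Bool
      {s′}             : State
      trace            : Trace M i as steps logM final as′
      execution        : Exec p s as cost log verdict s′ as′
      pads             : Pads logM log
      fits             : Fits t (lengths log)
      outcome          : HaltsWith M final verdict ⊎ (steps ≡ time × verdict ≡ false)

  open Simulated public

  module _ (x : Word) {B m : ℕ} where

    -- Three reserves are kept for the remaining clock `c`: the query tape of `M` stays within `B`
    -- although it may grow by one per step, the target stays at least `B` even if it loses `k` per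
    -- step, and padded words stay within `m` even if the target gains `k` per step.
    main-exec : ∀ c i as t {q} (b₂ : Bank (List Sym) tK) {l r} → SM.Bankwise SM.Exact (tapes i) l r →
      space (tapes i) + length c ≤ B → B + k * length c ≤ length t → length t + k * length c + k ≤ m →
      Simulated i as (length c) t (main (state i)) (words q (l , r) b₂ x [] [] c t) (mainCost m (length c))
    main-exec [] i as t b₂ e space≤ low high = record
      { trace = done ; execution = exec-leave (exec-bind exec-acts exec-ret) ; pads = []
      ; fits = fits-[] t ; outcome = inj₂ (refl , refl) }
    main-exec (o ∷ c) i as t {q} b₂ {l} {r} e space≤ low high = cases (M.instruction (state i)) refl
      where
      t′ : Word
      t′ = retarget t
      n : ℕ
      n = length c
      space<B : space (tapes i) < B
      space<B = ≤-trans (m≤m+n _ n) (≤-trans (≤-reflexive (sym (+-suc _ n))) space≤)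
      low′ : B + k * n ≤ length t′
      low′ = +-cancelʳ-≤ k _ _ (≤-trans (≤-reflexive (lemma B k n)) (≤-trans low (lower t)))
        where
        lemma : ∀ B k n → B + k * n + k ≡ B + k * suc n
        lemma = solve-∀
      high′ : length t′ + k * n + k ≤ m
      high′ = ≤-trans (+-monoˡ-≤ k (+-monoˡ-≤ (k * n) (upper t)))
                      (≤-trans (≤-reflexive (lemma (length t) k n)) high)
        where
        lemma : ∀ a k n → a + k + k * n + k ≡ a + k * suc n + k
        lemma = solve-∀
      k≤t : k ≤ length t
      k≤t = ≤-trans (m≤m*n k (suc n)) (≤-trans (m≤n+m _ B) low)

      tock : ∀ {j log a s as′} → j ≤ 5 + queryCost m →
        Exec (stepM (M.instruction (state i))) (words q (l , r) b₂ x [] [] c t′) as j log a s as′ →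
        Exec (bind (acts λ v → popC (letter (regC v))) (timed (state i)))
             (words q (l , r) b₂ x [] [] (o ∷ c) t) as (stepCost m) log a s as′
      tock j≤ r = exec-slack (+-monoʳ-≤ 3 (+-monoʳ-≤ (k * 3) (s≤s j≤)))
        (exec-bind exec-acts (exec-bind tick-exec r))

      cost-eq : stepCost m + suc (mainCost m n) ≡ mainCost m (suc n)
      cost-eq = lemma (stepCost m) (n * suc (stepCost m))
        where
        lemma : ∀ a b → a + suc (b + 3) ≡ suc a + b + 3
        lemma = solve-∀

      later : ∀ {d b steps} → HaltsWith M d b ⊎ (steps ≡ n × b ≡ false) →
        HaltsWith M d b ⊎ (suc steps ≡ suc n × b ≡ false)
      later (inj₁ h)         = inj₁ h
      later (inj₂ (eq , b≡)) = inj₂ (cong suc eq , b≡)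

      cases : ∀ instr → M.instruction (state i) ≡ instr →
        Simulated i as (suc n) t (main (state i)) (words q (l , r) b₂ x [] [] (o ∷ c) t)
                  (mainCost m (suc n))
      cases (halt b) eq = record
        { trace = done
        ; execution = exec-slack (≤-trans (n≤1+n _) (≤-trans (m≤m+n _ _) (m≤m+n _ 3)))
            (exec-leave (tock z≤n (exec-prog (cong stepM (sym eq)) exec-ret)))
        ; pads = [] ; fits = fits-[] t ; outcome = inj₁ eq }
      cases (move δ) eq =
        let l′ , r′ , e′ , r = moveM-exec δ e
            next = main-exec c (perform M (δ (mapᵛ scanned (tapes i))) i) as t′ b₂ e′
              (≤-trans (+-monoˡ-≤ n (space-move (proj₂ (δ (mapᵛ scanned (tapes i)))) (tapes i)))
                       (≤-trans (≤-reflexive (sym (+-suc _ n))) space≤))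
              low′ high′
        in record
        { trace = step eq (trace next)
        ; execution = exec-cost cost-eq
            (exec-again (tock (m≤m+n 5 _) (exec-prog (cong stepM (sym eq)) r)) (execution next))
        ; pads = pads next ; fits = fits-tick t (fits next) ; outcome = later {final next} (outcome next) }
      cases (query y z) eq =
        let w′ , q′ , b₂′ , w↝w′ , t≤ , <t+k , r =
              queryM-exec {y} {z} {m} {q} {b₂} {x} {c} {t′} {as} e
                (≤-trans space<B (≤-trans (m≤m+n B _) low′)) (≤-trans (+-monoˡ-≤ k (m≤m+n _ _)) high′)
            next = main-exec c (config (if answer as then y else z) (tapes i)) (rest as) t′ b₂′ e
              (≤-trans (+-monoʳ-≤ (space (tapes i)) (n≤1+n n)) space≤) low′ high′
        in record
        { trace = ask eq (trace next)
        ; execution = exec-cost cost-eq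
            (exec-again (tock (m≤n+m _ 5) (exec-prog (cong stepM (sym eq)) r)) (execution next))
        ; pads = w↝w′ ∷ pads next ; fits = fits-query t k≤t t≤ <t+k (fits next)
        ; outcome = later {final next} (outcome next) }

  -- The summand `2 + n` puts the clock above `p(n)`, so that a run of `M` within its time bound is
  -- not cut off, and above the length of the input, which the first query has to exceed. For a
  -- clock of length `c` the target is `(c + 1) + k * c`: the first part bounds the query words of
  -- `M`, the second is what `c` downward moves can consume.
  clock target : Polynomial → Polynomial
  clock p  = p ⊕ (2 ∷ 1 ∷ [])
  target p = map (suc k *_) (clock p) ⊕ (1 ∷ [])

  eval-clock : ∀ p n → eval (clock p) n ≡ eval p n + (2 + n)
  eval-clock p n = trans (eval-⊕ p (2 ∷ 1 ∷ []) n) (cong (eval p n +_) (lemma n))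
    where
    lemma : ∀ n → 2 + n * (1 + n * 0) ≡ 2 + n
    lemma = solve-∀

  eval-target : ∀ p n → eval (target p) n ≡ suc (eval (clock p) n) + k * eval (clock p) n
  eval-target p n = trans (eval-⊕ (map (suc k *_) (clock p)) (1 ∷ []) n)
    (trans (cong (_+ (1 + n * 0)) (eval-scale (suc k) (clock p) n)) (lemma k n (eval (clock p) n)))
    where
    lemma : ∀ k n c → suc k * c + (1 + n * 0) ≡ suc c + k * c
    lemma = solve-∀

  -- The target comes first because `horner` needs C as an empty scratch register, whereas T may
  -- hold any word meanwhile.
  program : Polynomial → Prog Bool
  program p = bind load λ _ → bind (horner (target p)) λ _ → bind V→T λ _ →
              bind (horner (clock p)) λ _ → bind V→C λ _ → main M.start

  -- The initial target, an increase by `k` for every tick of the clock, and the width of one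
  -- window.
  wordBound : Polynomial → ℕ → ℕ
  wordBound p n = eval (target p) n + k * eval (clock p) n + k

  programCost : Polynomial → ℕ → ℕ
  programCost p n = loadCost n + suc (hornerCost (target p) n + suc (2 + eval (target p) n * 3 + suc
    (hornerCost (clock p) n + suc (2 + eval (clock p) n * 3 + suc (mainCost (wordBound p n) (eval (clock p) n))))))

  program-exec : ∀ p x as → ∃[ t ] (length t ≡ eval (target p) (length x) ×
    Simulated (initial M x) as (eval (clock p) (length x)) t (program p) (initialState x)
              (programCost p (length x)))
  program-exec p x as
    with l , r , e , loaded ← load-exec x {as}
    with v , |v| , evaluated ← horner-exec [] (l , r) (replicateᵛ tK [] , replicateᵛ tK []) {x} {[]} {as} (target p)
    with v′ , |v′| , evaluated′ ← horner-exec [] (l , r) (replicateᵛ tK [] , replicateᵛ tK []) {x} {v ʳ++ []} {as} (clock p) =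
    t , |t| , record
      { trace     = trace sim
      ; execution = exec-bind loaded (exec-bind evaluated (exec-bind
          (exec-cost (cong (λ m → 2 + m * 3) |v|)
            (drain-exec (λ t v → words [] (l , r) b₂ x [] v [] t) (λ _ _ _ → refl) (λ _ _ _ → refl) (λ _ → refl) [] v))
          (exec-bind evaluated′ (exec-bind
            (exec-cost (cong (λ m → 2 + m * 3) |v′|)
              (drain-exec (λ c v → words [] (l , r) b₂ x [] v c t) (λ _ _ _ → refl) (λ _ _ _ → refl) (λ _ → refl) [] v′))
            (exec-cost (cong (mainCost (wordBound p (length x))) |c|) (execution sim))))))
      ; pads      = pads sim
      ; fits      = fits sim
      ; outcome   = timeout (outcome sim)
      }
    where
    b₂ : Bank (List Sym) tK
    b₂ = replicateᵛ tK [] , replicateᵛ tK []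
    t c : Word
    t = v ʳ++ []
    c = v′ ʳ++ []
    |t| : length t ≡ eval (target p) (length x)
    |t| = trans (length-reverse v) |v|
    |c| : length c ≡ eval (clock p) (length x)
    |c| = trans (length-reverse v′) |v′|
    low : suc (length c) + k * length c ≤ length t
    low = ≤-reflexive (sym (trans |t| (trans (eval-target p (length x))
                                             (cong (λ m → suc m + k * m) (sym |c|)))))
    high : length t + k * length c + k ≤ wordBound p (length x)
    high = ≤-reflexive (cong₂ (λ t c → t + k * c + k) |t| |c|)
    sim : Simulated (initial M x) as (length c) t (main M.start) (words [] (l , r) b₂ x [] [] c t)
                    (mainCost (wordBound p (length x)) (length c))
    sim = main-exec x c (initial M x) as t b₂ e ≤-refl low high
    timeout : HaltsWith M (final sim) (verdict sim) ⊎ (steps sim ≡ length c × verdict sim ≡ false) →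
      HaltsWith M (final sim) (verdict sim) ⊎ (steps sim ≡ eval (clock p) (length x) × verdict sim ≡ false)
    timeout (inj₁ h)           = inj₁ h
    timeout (inj₂ (eq , b≡)) = inj₂ (trans eq |c| , b≡)

  programCost-bounded : ∀ p → PolyBounded (programCost p)
  programCost-bounded p =
    bounded-+ load-bounded (bounded-+ 1-bounded (bounded-+ (hornerCost-bounded (target p)) (bounded-+ 1-bounded
      (bounded-+ (linear target-bounded) (bounded-+ 1-bounded
        (bounded-+ (hornerCost-bounded (clock p)) (bounded-+ 1-bounded
          (bounded-+ (linear clock-bounded) (bounded-+ 1-bounded main-bounded)))))))))
    where
    1-bounded : PolyBounded (λ _ → 1)
    1-bounded = bounded-const 1
    linear : ∀ {f} → PolyBounded f → PolyBounded (λ n → 2 + f n * 3)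
    linear f-bounded = bounded-+ (bounded-const 2) (bounded-* f-bounded (bounded-const 3))
    load-bounded : PolyBounded loadCost
    load-bounded = bounded-+ (linear bounded-id) (bounded-+ (bounded-const 4)
      (bounded-+ (linear bounded-id) (bounded-const 3)))
    clock-bounded : PolyBounded (eval (clock p))
    clock-bounded = bounded-eval (clock p) bounded-id
    target-bounded : PolyBounded (eval (target p))
    target-bounded = bounded-eval (target p) bounded-id
    word-bounded : PolyBounded (wordBound p)
    word-bounded = bounded-+ (bounded-+ target-bounded (bounded-* (bounded-const k) clock-bounded)) (bounded-const k)
    last-bounded : PolyBounded (λ n → lastRoundCost (wordBound p n))
    last-bounded = bounded-+ (bounded-const 3) (bounded-+ (linear word-bounded) (bounded-+ 1-bounded
      (bounded-+ (linear word-bounded) 1-bounded)))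
    round-bounded : PolyBounded (λ n → padRoundCost (wordBound p n))
    round-bounded = bounded-+ (bounded-const 3) (bounded-+ (linear word-bounded) (bounded-+ 1-bounded
      (bounded-+ (linear word-bounded) (bounded-+ (bounded-const 4)
        (bounded-+ (bounded-* (bounded-eval pσ word-bounded) (bounded-const 6))
          (bounded-+ 1-bounded (bounded-+ (linear word-bounded) 1-bounded)))))))
    pad-bounded : PolyBounded (λ n → padCost (wordBound p n) (wordBound p n))
    pad-bounded = bounded-+ (bounded-* word-bounded (bounded-+ 1-bounded round-bounded)) last-bounded
    query-bounded : PolyBounded (λ n → queryCost (wordBound p n))
    query-bounded = bounded-+ (bounded-+ (linear word-bounded) (bounded-+ 1-bounded (linear word-bounded)))
      (bounded-+ 1-bounded (bounded-+ pad-bounded (bounded-const 3)))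
    step-bounded : PolyBounded (λ n → stepCost (wordBound p n))
    step-bounded = bounded-+ (bounded-const 3) (bounded-+ (bounded-const (k * 3)) (bounded-+ (bounded-const 6) query-bounded))
    main-bounded : PolyBounded (λ n → mainCost (wordBound p n) (eval (clock p) n))
    main-bounded = bounded-+ (bounded-* clock-bounded (bounded-+ 1-bounded step-bounded)) (bounded-const 3)

  opaque

    simulator : Polynomial → Machine
    simulator p = compile E-finite (program p)

    simulator-trace : ∀ {p x as time t cost}
      (sim : Simulated (initial M x) as time t (program p) (initialState x) cost) →
      ∃[ n ] ∃[ c ] (n ≤ cost ×
        Trace (simulator p) (initial (simulator p) x) as n (log sim) c (as′ sim) ×
        HaltsWith (simulator p) c (verdict sim))
    simulator-trace {p} {x} {as} {cost = cost} sim = compile-run E-finite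
      (subst (λ s → Run (program p) s as cost (log sim) (verdict sim) (flat (s′ sim)) (as′ sim))
             (initial-flat x) (run (execution sim)))

-- The reductions

module _ (M : Machine) {A S : Language} (dptm : IsDPTM M) (decides : Decides M S A)
  (K : Machine) {σ : Word → Word} {k : ℕ} {pσ : Polynomial}
  (computes : ∀ x → ComputesWithin K x (σ x) (eval pσ (length x)))
  (preserves : ∀ x → σ x ∈ S ⇔ x ∈ S)
  (grows : ∀ x → length x < length (σ x))
  (tight : ∀ x → length (σ x) ≤ length x + k)
  (strategy : Reduction.Strategy M K {pσ = pσ} computes grows tight) where

  open Simulate M K {pσ = pσ} computes grows tight strategy

  private
    p : Polynomial
    p = proj₁ dptm

  pad-member : ∀ {w w′} → w ↝ w′ → w′ ∈ S ⇔ w ∈ S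
  pad-member stop     = mk⇔ id id
  pad-member (more s) = mk⇔ (Equivalence.to (preserves _) ∘ Equivalence.to (pad-member s))
                            (Equivalence.from (pad-member s) ∘ Equivalence.from (preserves _))

  -- Both directions are used: completeness carries right answers from `M` to the simulator,
  -- soundness carries them back. Negative answers use `pad-member` the other way round.
  pads-correct : ∀ {log log′} → Pads log log′ → All (Correct S) log ⇔ All (Correct S) log′
  pads-correct [] = mk⇔ (λ _ → []) (λ _ → [])
  pads-correct (_∷_ {b = true} w↝w′ ps) =
    mk⇔ (λ { (c ∷ cs) → Equivalence.from (pad-member w↝w′) c ∷ Equivalence.to (pads-correct ps) cs })
        (λ { (c ∷ cs) → Equivalence.to (pad-member w↝w′) c ∷ Equivalence.from (pads-correct ps) cs })
  pads-correct (_∷_ {b = false} w↝w′ ps) =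
    mk⇔ (λ { (c ∷ cs) → (c ∘ Equivalence.to (pad-member w↝w′)) ∷ Equivalence.to (pads-correct ps) cs })
        (λ { (c ∷ cs) → (c ∘ Equivalence.from (pad-member w↝w′)) ∷ Equivalence.from (pads-correct ps) cs })

  verdict-unique : ∀ N {c b b′} → HaltsWith N c b → HaltsWith N c b′ → b ≡ b′
  verdict-unique N h h′ with refl ← trans (sym h) h′ = refl

  -- A computation with any oracle is a trace along some list of answers, and along that list the
  -- simulator halts within `programCost`; determinism excludes longer traces.
  simulator-dptm : IsDPTM (simulator p)
  simulator-dptm = proj₁ (programCost-bounded p) , λ X x comp →
    let as , _ , t , _ = computation⇒trace (simulator p) comp
        _ , _ , sim = program-exec p x as
        _ , _ , n≤ , t′ , halts = simulator-trace sim
    in ≤-trans (trace-≤ (simulator p) t′ (_ , halts) t)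
               (≤-trans n≤ (proj₂ (programCost-bounded p) (length x)))

  module _ {x : Word} {as : List Bool} {t : Word} {cost : ℕ}
    (sim : Simulated (initial M x) as (eval (clock p) (length x)) t (program p) (initialState x) cost) where

    -- An exhausted clock rejects, so an accepting verdict is the verdict of `M` itself.
    sound : All (Correct S) (log sim) → verdict sim ≡ true → x ∈ L M S
    sound correct accepting = decided (outcome sim)
      where
      decided : HaltsWith M (final sim) (verdict sim) ⊎ (_ × verdict sim ≡ false) → x ∈ L M S
      decided (inj₁ h) = steps sim , _ , final sim ,
        trace⇒computation M (trace sim) (Equivalence.from (pads-correct (pads sim)) correct) ,
        subst (HaltsWith M (final sim)) accepting h
      decided (inj₂ (_ , rejecting)) with () ← trans (sym accepting) rejecting

    complete : ∀ {n log c as′} → Trace M (initial M x) as n log c as′ → n ≤ eval p (length x) →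
      HaltsWith M c true → All (Correct S) log → All (Correct S) (Simulated.log sim) × verdict sim ≡ true
    complete {c = c} u n≤ accepts correct = decided (outcome sim)
      where
      decided : HaltsWith M (final sim) (verdict sim) ⊎ (steps sim ≡ eval (clock p) (length x) × _) →
        All (Correct S) (Simulated.log sim) × verdict sim ≡ true
      decided (inj₁ h) =
        let c≡ , log≡ = trace-unique M (trace sim) (_ , h) u (_ , accepts)
        in Equivalence.to (pads-correct (pads sim)) (subst (All (Correct S)) (sym log≡) correct) ,
           verdict-unique M {c} (subst (λ c → HaltsWith M c (verdict sim)) c≡ h) accepts
      -- An exhausted clock would give `M` a trace of more than `p(n)` steps along answers with
      -- which it halts within `p(n)` steps.
      decided (inj₂ (steps≡ , _)) = ⊥-elim (<⇒≱ (begin-strict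
        _                                ≤⟨ n≤ ⟩
        eval p (length x)                <⟨ m<m+n _ z<s ⟩
        eval p (length x) + (2 + length x) ≡⟨ eval-clock p (length x) ⟨
        eval (clock p) (length x)        ≡⟨ steps≡ ⟨
        steps sim                        ∎) (trace-≤ M u (_ , accepts) (trace sim)))
        where open ≤-Reasoning

  simulator-sound : ∀ {x} → x ∈ L (simulator p) S → x ∈ L M S
  simulator-sound {x} (_ , _ , c , comp , accepts) =
    let as , _ , u , correct , _ = computation⇒trace (simulator p) comp
        _ , _ , sim = program-exec p x as
        _ , c′ , _ , u′ , halts = simulator-trace sim
        c≡ , log≡ = trace-unique (simulator p) u (_ , accepts) u′ (_ , halts)
    in sound sim (subst (All (Correct S)) log≡ correct)
         (verdict-unique (simulator p) {c′} halts (subst (λ c → HaltsWith (simulator p) c true) c≡ accepts))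

  simulator-complete : ∀ {x} → x ∈ L M S → x ∈ L (simulator p) S
  simulator-complete {x} (_ , _ , _ , comp , accepts) =
    let as , _ , u , correct , _ = computation⇒trace M comp
        _ , _ , sim = program-exec p x as
        n , c′ , _ , u′ , halts = simulator-trace sim
        correct′ , accepting = complete sim u (proj₂ dptm S x comp) accepts correct
    in n , _ , c′ , trace⇒computation (simulator p) u′ correct′ ,
       subst (HaltsWith (simulator p) c′) accepting halts

  simulator-queries : ∀ x {qs} → Queries (simulator p) S x qs →
    ∃[ t ] (length t ≡ eval (target p) (length x) × Fits t (map length qs))
  simulator-queries x (_ , _ , comp , halts) =
    let as , _ , u , _ , qs≡ = computation⇒trace (simulator p) comp
        t , |t| , sim = program-exec p x as
        _ , _ , _ , u′ , halts′ = simulator-trace sim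
        _ , log≡ = trace-unique (simulator p) u′ (_ , halts′) u halts
    in t , |t| , subst (λ qs → Fits t (map length qs)) (trans (cong (map proj₁) log≡) qs≡) (fits sim)

  reduction : ∀ {P} → (∀ n t ls → n < length t → Fits t ls → P n ls) → RestrictedReduction P A S
  reduction fits⇒P = simulator p , simulator-dptm ,
    (λ x → mk⇔ (Equivalence.to (decides x) ∘ simulator-sound)
               (simulator-complete ∘ Equivalence.from (decides x))) ,
    λ x queries → let t , |t| , fit = simulator-queries x queries
                  in inj₂ (fits⇒P (length x) t _ (≤-trans (n<target (length x)) (≤-reflexive (sym |t|))) fit)
    where
    n<target : ∀ n → n < eval (target p) n
    n<target n = begin
      suc n                                        ≤⟨ s≤s (≤-trans (m≤n+m n _) (≤-reflexive (+-assoc (eval p n) 2 n))) ⟩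
      suc (eval p n + (2 + n))                     ≡⟨ cong suc (eval-clock p n) ⟨
      suc (eval (clock p) n)                       ≤⟨ m≤m+n _ _ ⟩
      suc (eval (clock p) n) + k * eval (clock p) n ≡⟨ eval-target p n ⟨
      eval (target p) n                            ∎
      where open ≤-Reasoning

theorem6p1 : (S : Language) → TightPaddable S → (A : Language) →
    ((A ≤ᵖT S) ⇔ (A ≤ᵖli-T S)) ×
    ((A ≤ᵖT S) ⇔ (A ≤ᵖld-T S)) ×
    ((A ≤ᵖT S) ⇔ (A ≤ᵖs-li-T S))
theorem6p1 S (σ , k , (K , _ , pσ , computes) , padding) A =
  mk⇔ (λ (M , dptm , decides) → li M dptm decides)
      (λ (M , dptm , decides , _) → M , dptm , decides) ,
  mk⇔ (λ (M , dptm , decides) → ld M dptm decides)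
      (λ (M , dptm , decides , _) → M , dptm , decides) ,
  mk⇔ (λ (M , dptm , decides) → s-li M dptm decides)
      (λ (M , dptm , decides , _) → M , dptm , decides)
  where
  preserves : ∀ x → σ x ∈ S ⇔ x ∈ S
  preserves x = proj₁ (padding x)
  grows : ∀ x → length x < length (σ x)
  grows x = proj₁ (proj₂ (padding x))
  tight : ∀ x → length (σ x) ≤ length x + k
  tight x = proj₂ (proj₂ (padding x))

  module _ (M : Machine) (dptm : IsDPTM M) (decides : Decides M S A) where

    open Reduction M K {k = k} {pσ = pσ} computes grows tight

    s-li : A ≤ᵖs-li-T S
    s-li = reduction M dptm decides K {pσ = pσ} computes preserves grows tight increasing
      -- The input acts as the length preceding the first query.
      {λ n ls → Linked _<_ (n ∷ ls)} λ n t ls n<t fits → fits n (≤-trans n<t (m≤m+n _ k))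

    li : A ≤ᵖli-T S
    li = reduction M dptm decides K {pσ = pσ} computes preserves grows tight increasing
      {λ n ls → Linked _<_ ls} λ n t ls n<t fits → linked-tail (fits n (≤-trans n<t (m≤m+n _ k)))

    ld : A ≤ᵖld-T S
    ld = reduction M dptm decides K {pσ = pσ} computes preserves grows tight decreasing
      -- A fictitious length equal to the initial target precedes the first query and is then
      -- dropped.
      {λ n ls → Linked _>_ ls} λ n t ls n<t fits → linked-tail (fits (length t) ≤-refl)
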